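{- If $N:\langle\Gamma\vdash U\rangle$ is derivable and $M\rhd^*_\beta N$, then $M:\langle\Gamma\uparrow^M\vdash U\rangle$ is derivable.
   Context: Indexes: finite sequences of natural numbers ($\mathcal L_{\mathbb N}$), $\oslash$ empty, $i::L$ prepending $i$, $L_1\preceq L_2$ (also $L_2\succeq L_1$) iff $L_2=L_1::L_3$ for some $L_3$ (concatenation). Terms: over a countably infinite set $\mathcal V$, terms $\mathcal M$, free indexed variables $\mathrm{fv}$, degree $d$, joinability $\diamond$ defined simultaneously: $x^L\in\mathcal M$ ($\mathrm{fv}=\{x^L\}$, $d=L$); $MN\in\mathcal M$ when $d(M)\preceq d(N)$, $M\diamond N$ ($\mathrm{fv}$ union, $d(MN)=d(M)$); $\lambda x^L.M\in\mathcal M$ when $L\succeq d(M)$ ($\mathrm{fv}(M)\setminus\{x^L\}$, $d=d(M)$). $M\diamond N$ iff $x^L\in\mathrm{fv}(M)$, $x^K\in\mathrm{fv}(N)$ imply $L=K$. Terms modulo $\alpha$; $M[x^L:=N]$ defined only if $M\diamond N$ and $d(N)=L$. $\rhd_\beta$: least relation compatible with abstraction and application containing $(\lambda x^L.M)N\rhd_\beta M[x^L:=N]$ ($d(N)=L$); $\rhd^*_\beta$ its reflexive–transitive closure. Lifting $(x^L)^{+i}=x^{i::L}$, $(M_1M_2)^{+i}=M_1^{+i}M_2^{+i}$, $(\lambda x^L.M)^{+i}=\lambda x^{i::L}.M^{+i}$. Types: atomic types $\mathcal A$, expansion variables $\overline e_0,\overline e_1,\dots$; $\mathbb T\subseteq\mathbb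 U$ with degree: $a\in\mathbb T$ ($d=\oslash$); $U\to T\in\mathbb T$ for $U\in\mathbb U,T\in\mathbb T$ ($d=\oslash$); $\omega^L\in\mathbb U$ ($d=L$); $U_1\sqcap U_2$ if $d(U_1)=d(U_2)$; $\overline e_iU$ ($d=i::d(U)$); modulo $\sqcap$ commutative, associative, idempotent, $\overline e_i(U_1\sqcap U_2)=\overline e_iU_1\sqcap\overline e_iU_2$, $\omega^L\sqcap U=U$ ($d(U)=L$), $\overline e_i\omega^K=\omega^{i::K}$. Environments: finite sets of declarations $x^L:U$ (at most one per $x^L$); $\Gamma,\Delta$ disjoint union; $env^\omega_M$ assigns $\omega^L$ to each $x^L\in\mathrm{fv}(M)$; $\Gamma_1\sqcap\Gamma_2$ intersects types of common variables, keeps others; $\overline e_j\Gamma$ replaces $x^L:U$ by $x^{j::L}:\overline e_jU$; $\Gamma_1\diamond\Gamma_2$ iff $x^L\in\mathrm{dom}\,\Gamma_1$, $x^K\in\mathrm{dom}\,\Gamma_2$ imply $L=K$. If $\mathrm{dom}\,\Gamma\subseteq\mathrm{fv}(M)$, $\Gamma\uparrow^M$ is $\Gamma$ extended with $x^L:\omega^L$ for each $x^L\in\mathrm{fv}(M)\setminus\mathrm{dom}\,\Gamma$. Subtyping $\sqsubseteq$: least relation on types, environments and typings closed under reflexivity, transitivity, $U_1\sqcap U_2\sqsubseteq U_1$ ($d(U_1)=d(U_2)$), $U_1\sqcap U_2\sqsubseteq V_1\sqcap V_2$ if $U_i\sqsubseteq V_i$, $U_1\to T_1\sqsubseteq U_2\to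 T_2$ if $U_2\sqsubseteq U_1$, $T_1\sqsubseteq T_2$, $\overline e_iU_1\sqsubseteq\overline e_iU_2$ if $U_1\sqsubseteq U_2$, $\Gamma,y^L:U_1\sqsubseteq\Gamma,y^L:U_2$ if $U_1\sqsubseteq U_2$, $\langle\Gamma_1\vdash U_1\rangle\sqsubseteq\langle\Gamma_2\vdash U_2\rangle$ if $U_1\sqsubseteq U_2$, $\Gamma_2\sqsubseteq\Gamma_1$. Typing rules ($T\in\mathbb T$): (ax) $x^\oslash:\langle(x^\oslash:T)\vdash T\rangle$; ($\omega$) $M:\langle env^\omega_M\vdash\omega^{d(M)}\rangle$; ($\to_I$) $M:\langle\Gamma,(x^L:U)\vdash T\rangle\Rightarrow\lambda x^L.M:\langle\Gamma\vdash U\to T\rangle$; ($\to'_I$) $M:\langle\Gamma\vdash T\rangle$, $x^L\notin\mathrm{dom}\,\Gamma\Rightarrow\lambda x^L.M:\langle\Gamma\vdash\omega^L\to T\rangle$; ($\to_E$) $M_1:\langle\Gamma_1\vdash U\to T\rangle$, $M_2:\langle\Gamma_2\vdash U\rangle$, $\Gamma_1\diamond\Gamma_2\Rightarrow M_1M_2:\langle\Gamma_1\sqcap\Gamma_2\vdash T\rangle$; ($\sqcap_I$) $M:\langle\Gamma\vdash U_1\rangle$, $M:\langle\Gamma\vdash U_2\rangle\Rightarrow M:\langle\Gamma\vdash U_1\sqcap U_2\rangle$; ($e$) $M:\langle\Gamma\vdash U\rangle\Rightarrow M^{+j}:\langle\overline e_j\Gamma\vdash\overline e_jU\rangle$; ($\sqsubseteq$)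 $M:\langle\Gamma\vdash U\rangle$, $\langle\Gamma\vdash U\rangle\sqsubseteq\langle\Gamma'\vdash U'\rangle\Rightarrow M:\langle\Gamma'\vdash U'\rangle$. -}

module Defs where

open import Data.Nat using (ℕ; _≟_)
open import Data.List using (List; []; _∷_; _++_; map; filter; deduplicate)
open import Data.List.Membership.Propositional using (_∈_; _∉_)
import Data.List.Membership.DecPropositional as DecMem
open import Data.Product using (_×_; _,_; proj₁; proj₂; ∃-syntax)
open import Data.Product.Properties using (≡-dec)
import Data.List.Properties as LP
open import Data.Maybe using (Maybe; just; nothing)
open import Relation.Binary.PropositionalEquality using (_≡_; _≢_)
open import Relation.Binary.Definitions using (DecidableEquality)
open import Relation.Nullary using (¬_; yes; no; ¬?)

Index : Set
Index = List ℕ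

_⪯_ : Index → Index → Set
L₁ ⪯ L₂ = ∃[ L₃ ] L₂ ≡ L₁ ++ L₃

-- Indexed variables x^L  (the countably infinite set 𝒱 is ℕ)

Var : Set
Var = ℕ × Index

_≟ᵥ_ : DecidableEquality Var
_≟ᵥ_ = ≡-dec _≟_ (LP.≡-dec _≟_)

open DecMem _≟ᵥ_ using () renaming (_∈?_ to _∈ᵥ?_)

-- Raw (pre-)terms; 𝓜 is carved out by Tm, α is the relation _=α_

data Λ : Set where
  var : ℕ → Index → Λ
  app : Λ → Λ → Λ
  lam : ℕ → Index → Λ → Λ

fv : Λ → List Var
fv (var x L)   = (x , L) ∷ []
fv (app M N)   = fv M ++ fv N
fv (lam x L M) = filter (λ v → ¬? (v ≟ᵥ (x , L))) (fv M)

_⋄_ : Λ → Λ → Set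
M ⋄ N = ∀ x L K → (x , L) ∈ fv M → (x , K) ∈ fv N → L ≡ K

-- Tm M L : M ∈ 𝓜 and d(M) = L
data Tm : Λ → Index → Set where
  tvar : ∀ x L → Tm (var x L) L
  tapp : ∀ {M N L K} → Tm M L → Tm N K → L ⪯ K → M ⋄ N → Tm (app M N) L
  tlam : ∀ {x L M K} → Tm M K → K ⪯ L → Tm (lam x L M) K

lift : ℕ → Λ → Λ
lift i (var x L)   = var x (i ∷ L)
lift i (app M N)   = app (lift i M) (lift i N)
lift i (lam x L M) = lam x (i ∷ L) (lift i M)

swapᵥ : Var → Var → Var → Var
swapᵥ a b v with v ≟ᵥ a | v ≟ᵥ b
... | yes _ | _     = b
... | no _  | yes _ = a
... | no _  | no _  = v

swap : Var → Var → Λ → Λ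
swap a b (var x L)   = var (proj₁ (swapᵥ a b (x , L))) (proj₂ (swapᵥ a b (x , L)))
swap a b (app M N)   = app (swap a b M) (swap a b N)
swap a b (lam x L M) = lam (proj₁ (swapᵥ a b (x , L))) (proj₂ (swapᵥ a b (x , L))) (swap a b M)

data _=α_ : Λ → Λ → Set where
  α-var : ∀ x L → var x L =α var x L
  α-app : ∀ {M M' N N'} → M =α M' → N =α N' → app M N =α app M' N'
  α-lam : ∀ {x y z L M N} →
          (z , L) ∉ fv (lam x L M) → (z , L) ∉ fv (lam y L N) →
          swap (x , L) (z , L) M =α swap (y , L) (z , L) N →
          lam x L M =α lam y L N

-- Subst M v N P : P is (a representative of) the capture-avoiding M[v := N]
data Subst : Λ → Var → Λ → Λ → Set where
  s-var≡ : ∀ {x L v N} → (x , L) ≡ v → Subst (var x L) v N N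
  s-var≢ : ∀ {x L v N} → (x , L) ≢ v → Subst (var x L) v N (var x L)
  s-app  : ∀ {M₁ M₂ v N P₁ P₂} → Subst M₁ v N P₁ → Subst M₂ v N P₂ →
           Subst (app M₁ M₂) v N (app P₁ P₂)
  s-lam≡ : ∀ {y K M v N} → (y , K) ≡ v → Subst (lam y K M) v N (lam y K M)
  s-lam≢ : ∀ {y z K M v N P} → (y , K) ≢ v →
           (z , K) ∉ fv (lam y K M) → (z , K) ∉ fv N → (z , K) ≢ v →
           Subst (swap (y , K) (z , K) M) v N P →
           Subst (lam y K M) v N (lam z K P)

data _▷β_ : Λ → Λ → Set where
  β     : ∀ {x L M N P} → Tm N L → M ⋄ N → Subst M (x , L) N P →
          app (lam x L M) N ▷β P
  ▷-appˡ : ∀ {M M' N} → M ▷β M' → app M N ▷β app M' N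
  ▷-appʳ : ∀ {M N N'} → N ▷β N' → app M N ▷β app M N'
  ▷-lam  : ∀ {x L M M'} → M ▷β M' → lam x L M ▷β lam x L M'

data _▷β*_ : Λ → Λ → Set where
  ▷*-α    : ∀ {M N} → M =α N → M ▷β* N
  ▷*-step : ∀ {M M' N} → M ▷β M' → M' ▷β* N → M ▷β* N
  ▷*-αstep : ∀ {M M' N} → M =α M' → M' ▷β* N → M ▷β* N

mutual
  data TyT : Set where
    atom : ℕ → TyT
    _⇒_  : TyU → TyT → TyT

  data TyU : Set where
    ⌜_⌝ : TyT → TyU
    ω   : Index → TyU
    _⊓_ : TyU → TyU → TyU
    ē   : ℕ → TyU → TyU

infixr 7 _⇒_
infixl 8 _⊓_

mutual
  data WfT : TyT → Set where
    wf-atom : ∀ a → WfT (atom a)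
    wf-⇒    : ∀ {U T L} → DegU U L → WfT T → WfT (U ⇒ T)

  data DegU : TyU → Index → Set where
    d-T : ∀ {T} → WfT T → DegU ⌜ T ⌝ []
    d-ω : ∀ L → DegU (ω L) L
    d-⊓ : ∀ {U₁ U₂ L} → DegU U₁ L → DegU U₂ L → DegU (U₁ ⊓ U₂) L
    d-e : ∀ {i U L} → DegU U L → DegU (ē i U) (i ∷ L)

data _≈_ : TyU → TyU → Set where
  ≈-refl  : ∀ {U} → U ≈ U
  ≈-sym   : ∀ {U V} → U ≈ V → V ≈ U
  ≈-trans : ∀ {U V W} → U ≈ V → V ≈ W → U ≈ W
  ≈-⊓     : ∀ {U₁ U₂ V₁ V₂} → U₁ ≈ V₁ → U₂ ≈ V₂ → (U₁ ⊓ U₂) ≈ (V₁ ⊓ V₂)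
  ≈-ē     : ∀ {i U V} → U ≈ V → ē i U ≈ ē i V
  ≈-⇒     : ∀ {U V T T'} → U ≈ V → ⌜ T ⌝ ≈ ⌜ T' ⌝ → ⌜ U ⇒ T ⌝ ≈ ⌜ V ⇒ T' ⌝
  ⊓-comm  : ∀ {U V} → (U ⊓ V) ≈ (V ⊓ U)
  ⊓-assoc : ∀ {U V W} → ((U ⊓ V) ⊓ W) ≈ (U ⊓ (V ⊓ W))
  ⊓-idem  : ∀ {U} → (U ⊓ U) ≈ U
  ē-distr : ∀ {i U V} → ē i (U ⊓ V) ≈ (ē i U ⊓ ē i V)
  ω-unit  : ∀ {U L} → DegU U L → (ω L ⊓ U) ≈ U
  ē-ω     : ∀ {i K} → ē i (ω K) ≈ ω (i ∷ K)

data _⊑_ : TyU → TyU → Set where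
  ⊑-≈     : ∀ {U V} → U ≈ V → U ⊑ V
  ⊑-trans : ∀ {U V W} → U ⊑ V → V ⊑ W → U ⊑ W
  ⊑-⊓ᵉ    : ∀ {U₁ U₂ L} → DegU U₁ L → DegU U₂ L → (U₁ ⊓ U₂) ⊑ U₁
  ⊑-⊓     : ∀ {U₁ U₂ V₁ V₂} → U₁ ⊑ V₁ → U₂ ⊑ V₂ → (U₁ ⊓ U₂) ⊑ (V₁ ⊓ V₂)
  ⊑-⇒     : ∀ {U₁ U₂ T₁ T₂} → U₂ ⊑ U₁ → ⌜ T₁ ⌝ ⊑ ⌜ T₂ ⌝ → ⌜ U₁ ⇒ T₁ ⌝ ⊑ ⌜ U₂ ⇒ T₂ ⌝
  ⊑-ē     : ∀ {i U₁ U₂} → U₁ ⊑ U₂ → ē i U₁ ⊑ ē i U₂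

-- Environments: finite sets of declarations x^L : U, represented as lists

Env : Set
Env = List (Var × TyU)

dom : Env → List Var
dom Γ = map proj₁ Γ

lookupE : Env → Var → Maybe TyU
lookupE [] v = nothing
lookupE ((w , U) ∷ Γ) v with v ≟ᵥ w
... | yes _ = just U
... | no _  = lookupE Γ v

_⊓ᴱ_ : Env → Env → Env
Γ₁ ⊓ᴱ Γ₂ = map meet Γ₁ ++ filter (λ d → ¬? (proj₁ d ∈ᵥ? dom Γ₁)) Γ₂
  where
  meet : Var × TyU → Var × TyU
  meet (v , U) with lookupE Γ₂ v
  ... | just V  = (v , U ⊓ V)
  ... | nothing = (v , U)

ēᴱ : ℕ → Env → Env
ēᴱ j Γ = map (λ d → ((proj₁ (proj₁ d) , j ∷ proj₂ (proj₁ d)) , ē j (proj₂ d))) Γ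

envω : Λ → Env
envω M = map (λ v → (v , ω (proj₂ v))) (deduplicate _≟ᵥ_ (fv M))

_↑_ : Env → Λ → Env
Γ ↑ M = Γ ++ map (λ v → (v , ω (proj₂ v)))
                 (filter (λ v → ¬? (v ∈ᵥ? dom Γ)) (deduplicate _≟ᵥ_ (fv M)))

_⋄ᴱ_ : Env → Env → Set
Γ₁ ⋄ᴱ Γ₂ = ∀ x L K → (x , L) ∈ dom Γ₁ → (x , K) ∈ dom Γ₂ → L ≡ K

_≐_ : Env → Env → Set
Γ ≐ Δ = ∀ d → (d ∈ Γ → d ∈ Δ) × (d ∈ Δ → d ∈ Γ)

data _⊑ᴱ_ : Env → Env → Set where
  ⊑ᴱ-refl  : ∀ {Γ Δ} → Γ ≐ Δ → Γ ⊑ᴱ Δ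
  ⊑ᴱ-trans : ∀ {Γ Δ Θ} → Γ ⊑ᴱ Δ → Δ ⊑ᴱ Θ → Γ ⊑ᴱ Θ
  ⊑ᴱ-ext   : ∀ {Γ y U₁ U₂} → y ∉ dom Γ → U₁ ⊑ U₂ → ((y , U₁) ∷ Γ) ⊑ᴱ ((y , U₂) ∷ Γ)

record Typing : Set where
  constructor ⟨_⊢_⟩
  field
    env : Env
    ty  : TyU

data _⊑ᵀ_ : Typing → Typing → Set where
  ⊑ᵀ-intro : ∀ {Γ₁ Γ₂ U₁ U₂} → U₁ ⊑ U₂ → Γ₂ ⊑ᴱ Γ₁ → ⟨ Γ₁ ⊢ U₁ ⟩ ⊑ᵀ ⟨ Γ₂ ⊢ U₂ ⟩

-- typing rules; the subjects range over 𝓜 (terms modulo α)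
data _∶_ : Λ → Typing → Set where
  ax   : ∀ {x T} → WfT T → var x [] ∶ ⟨ ((x , []) , ⌜ T ⌝) ∷ [] ⊢ ⌜ T ⌝ ⟩
  ω-r  : ∀ {M L} → Tm M L → M ∶ ⟨ envω M ⊢ ω L ⟩
  →I   : ∀ {x L M K Γ U T} → Tm (lam x L M) K → (x , L) ∉ dom Γ →
         M ∶ ⟨ ((x , L) , U) ∷ Γ ⊢ ⌜ T ⌝ ⟩ →
         lam x L M ∶ ⟨ Γ ⊢ ⌜ U ⇒ T ⌝ ⟩
  →'I  : ∀ {x L M K Γ T} → Tm (lam x L M) K → (x , L) ∉ dom Γ →
         M ∶ ⟨ Γ ⊢ ⌜ T ⌝ ⟩ →
         lam x L M ∶ ⟨ Γ ⊢ ⌜ ω L ⇒ T ⌝ ⟩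
  →E   : ∀ {M₁ M₂ K Γ₁ Γ₂ U T} → Tm (app M₁ M₂) K →
         M₁ ∶ ⟨ Γ₁ ⊢ ⌜ U ⇒ T ⌝ ⟩ → M₂ ∶ ⟨ Γ₂ ⊢ U ⟩ → Γ₁ ⋄ᴱ Γ₂ →
         app M₁ M₂ ∶ ⟨ Γ₁ ⊓ᴱ Γ₂ ⊢ ⌜ T ⌝ ⟩
  ⊓I   : ∀ {M Γ U₁ U₂} → M ∶ ⟨ Γ ⊢ U₁ ⟩ → M ∶ ⟨ Γ ⊢ U₂ ⟩ → M ∶ ⟨ Γ ⊢ U₁ ⊓ U₂ ⟩
  e-r  : ∀ {M Γ U} j → M ∶ ⟨ Γ ⊢ U ⟩ → lift j M ∶ ⟨ ēᴱ j Γ ⊢ ē j U ⟩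
  ⊑-r  : ∀ {M τ τ'} → M ∶ τ → τ ⊑ᵀ τ' → M ∶ τ'
  α-r  : ∀ {M M' τ} → M =α M' → M ∶ τ → M' ∶ τ

{-# OPTIONS --safe #-}
module Submission where

-- A type of degree L is, up to ≈, an intersection of types ē_L T with T ∈ 𝕋, so typing can be made
-- syntax-directed: Has M σ L T says that M has type ē_L T in a context σ that is total, undeclared
-- variables having type ω. In a total context the extension Γ ↑ M is invisible, and β-expansion needs
-- no bookkeeping of domains: a derivation for M[x := N] is one for M in which x has the intersection V
-- of the types given to the copies of N. As d(M) ⪯ d(N), V is ≈ to some ē_{d(M)} U, which is the form
-- required to type the redex. The typing rules are sound for Has, and on 𝓜 they are also complete.
-- Only completeness needs joinability. This matters because raw α-steps destroy it (renaming x^L to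
-- y^L may clash with a free y^K), so intermediate terms of a reduction need not be in 𝓜.

open import Data.Nat using (ℕ; suc; _≤_; s≤s)
import Data.Nat as ℕ
open import Data.Nat.Properties using (≤-refl; ≤-trans; m≤m+n; m≤n+m)
open import Data.List using (List; []; _∷_; _++_; map; filter; deduplicate)
open import Data.List.Properties using (++-assoc; ++-identityʳ; ∷-injectiveʳ)
open import Data.List.Membership.Propositional using (_∈_; _∉_)
open import Data.List.Membership.Propositional.Properties
  using (∈-map⁺; ∈-map⁻; ∈-++⁺ˡ; ∈-++⁺ʳ; ∈-++⁻; ∈-filter⁺; ∈-filter⁻; ∈-deduplicate⁺; ∈-deduplicate⁻)
import Data.List.Membership.DecPropositional as DecMembership
open import Data.List.Relation.Unary.Any using (here; there)
open import Data.List.Relation.Unary.All.Properties using (All¬⇒¬Any)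
open import Data.List.Relation.Unary.AllPairs using ([]; _∷_)
open import Data.List.Relation.Unary.Unique.Propositional using (Unique)
open import Data.List.Relation.Unary.Unique.DecPropositional.Properties using (deduplicate-!)
open import Data.Maybe using (just; nothing; fromMaybe)
open import Data.Product using (Σ; _×_; _,_; proj₁; proj₂; ∃-syntax)
open import Data.Sum using (_⊎_; inj₁; inj₂; [_,_])
open import Data.Unit using (⊤; tt)
open import Data.Empty using (⊥; ⊥-elim)
open import Relation.Binary.PropositionalEquality
  using (_≡_; _≢_; refl; sym; trans; cong; cong₂; subst; subst₂)
open import Relation.Nullary using (¬?; yes; no)
open import Relation.Nullary.Decidable using (toSum)

open import Defs

open DecMembership _≟ᵥ_ using (_∈?_)

-- Types and their degrees

⊑-refl : ∀ {U} → U ⊑ U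
⊑-refl = ⊑-≈ ≈-refl

⊑-reflexive : ∀ {U V} → U ≡ V → U ⊑ V
⊑-reflexive refl = ⊑-refl

DegU-unique : ∀ {U L K} → DegU U L → DegU U K → L ≡ K
DegU-unique (d-T _)   (d-T _)   = refl
DegU-unique (d-ω _)   (d-ω _)   = refl
DegU-unique (d-⊓ p _) (d-⊓ q _) = DegU-unique p q
DegU-unique (d-e p)   (d-e q)   = cong (_ ∷_) (DegU-unique p q)

DegU-T⁻ : ∀ {T L} → DegU ⌜ T ⌝ L → WfT T
DegU-T⁻ (d-T w) = w

mutual
  DegU-≈⇒ : ∀ {U V L} → U ≈ V → DegU U L → DegU V L
  DegU-≈⇒ ≈-refl        d                    = d
  DegU-≈⇒ (≈-sym p)     d                    = DegU-≈⇐ p d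
  DegU-≈⇒ (≈-trans p q) d                    = DegU-≈⇒ q (DegU-≈⇒ p d)
  DegU-≈⇒ (≈-⊓ p q)     (d-⊓ d d')           = d-⊓ (DegU-≈⇒ p d) (DegU-≈⇒ q d')
  DegU-≈⇒ (≈-ē p)       (d-e d)              = d-e (DegU-≈⇒ p d)
  DegU-≈⇒ (≈-⇒ p q)     (d-T (wf-⇒ d w))     = d-T (wf-⇒ (DegU-≈⇒ p d) (DegU-T⁻ (DegU-≈⇒ q (d-T w))))
  DegU-≈⇒ ⊓-comm        (d-⊓ d d')           = d-⊓ d' d
  DegU-≈⇒ ⊓-assoc       (d-⊓ (d-⊓ a b) c)    = d-⊓ a (d-⊓ b c)
  DegU-≈⇒ ⊓-idem        (d-⊓ d _)            = d
  DegU-≈⇒ ē-distr       (d-e (d-⊓ d d'))     = d-⊓ (d-e d) (d-e d')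
  DegU-≈⇒ (ω-unit _)    (d-⊓ _ d)            = d
  DegU-≈⇒ ē-ω           (d-e (d-ω _))        = d-ω _

  DegU-≈⇐ : ∀ {U V L} → U ≈ V → DegU V L → DegU U L
  DegU-≈⇐ ≈-refl        d                    = d
  DegU-≈⇐ (≈-sym p)     d                    = DegU-≈⇒ p d
  DegU-≈⇐ (≈-trans p q) d                    = DegU-≈⇐ p (DegU-≈⇐ q d)
  DegU-≈⇐ (≈-⊓ p q)     (d-⊓ d d')           = d-⊓ (DegU-≈⇐ p d) (DegU-≈⇐ q d')
  DegU-≈⇐ (≈-ē p)       (d-e d)              = d-e (DegU-≈⇐ p d)
  DegU-≈⇐ (≈-⇒ p q)     (d-T (wf-⇒ d w))     = d-T (wf-⇒ (DegU-≈⇐ p d) (DegU-T⁻ (DegU-≈⇐ q (d-T w))))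
  DegU-≈⇐ ⊓-comm        (d-⊓ d d')           = d-⊓ d' d
  DegU-≈⇐ ⊓-assoc       (d-⊓ a (d-⊓ b c))    = d-⊓ (d-⊓ a b) c
  DegU-≈⇐ ⊓-idem        d                    = d-⊓ d d
  DegU-≈⇐ ē-distr       (d-⊓ (d-e d) (d-e d')) = d-e (d-⊓ d d')
  DegU-≈⇐ (ω-unit p)    d with refl ← DegU-unique p d = d-⊓ (d-ω _) d
  DegU-≈⇐ ē-ω           (d-ω _)              = d-e (d-ω _)

mutual
  -- The arrow is contravariant in its domain, so degrees must travel against `⊑` as well; the
  -- premises of `⊑-⊓ᵉ` restore the degree of the discarded component.
  DegU-⊑⇒ : ∀ {U V L} → U ⊑ V → DegU U L → DegU V L
  DegU-⊑⇒ (⊑-≈ p)       d                = DegU-≈⇒ p d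
  DegU-⊑⇒ (⊑-trans p q) d                = DegU-⊑⇒ q (DegU-⊑⇒ p d)
  DegU-⊑⇒ (⊑-⊓ᵉ _ _)    (d-⊓ d _)        = d
  DegU-⊑⇒ (⊑-⊓ p q)     (d-⊓ d d')       = d-⊓ (DegU-⊑⇒ p d) (DegU-⊑⇒ q d')
  DegU-⊑⇒ (⊑-⇒ p q)     (d-T (wf-⇒ d w)) = d-T (wf-⇒ (DegU-⊑⇐ p d) (DegU-T⁻ (DegU-⊑⇒ q (d-T w))))
  DegU-⊑⇒ (⊑-ē p)       (d-e d)          = d-e (DegU-⊑⇒ p d)

  DegU-⊑⇐ : ∀ {U V L} → U ⊑ V → DegU V L → DegU U L
  DegU-⊑⇐ (⊑-≈ p)       d                = DegU-≈⇐ p d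
  DegU-⊑⇐ (⊑-trans p q) d                = DegU-⊑⇐ p (DegU-⊑⇐ q d)
  DegU-⊑⇐ (⊑-⊓ᵉ p q)    d with refl ← DegU-unique p d = d-⊓ d q
  DegU-⊑⇐ (⊑-⊓ p q)     (d-⊓ d d')       = d-⊓ (DegU-⊑⇐ p d) (DegU-⊑⇐ q d')
  DegU-⊑⇐ (⊑-⇒ p q)     (d-T (wf-⇒ d w)) = d-T (wf-⇒ (DegU-⊑⇒ p d) (DegU-T⁻ (DegU-⊑⇐ q (d-T w))))
  DegU-⊑⇐ (⊑-ē p)       (d-e d)          = d-e (DegU-⊑⇐ p d)

⊑-⊓ʳ : ∀ {U V L} → DegU U L → DegU V L → (U ⊓ V) ⊑ V
⊑-⊓ʳ d d' = ⊑-trans (⊑-≈ ⊓-comm) (⊑-⊓ᵉ d' d)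

⊑-ω : ∀ {U L} → DegU U L → U ⊑ ω L
⊑-ω d = ⊑-trans (⊑-≈ (≈-sym (ω-unit d))) (⊑-⊓ᵉ (d-ω _) d)

⊑-glb : ∀ {U V W} → U ⊑ V → U ⊑ W → U ⊑ (V ⊓ W)
⊑-glb p q = ⊑-trans (⊑-≈ (≈-sym ⊓-idem)) (⊑-⊓ p q)

ēs : Index → TyU → TyU
ēs []      U = U
ēs (i ∷ L) U = ē i (ēs L U)

ēs-mono : ∀ L {U V} → U ⊑ V → ēs L U ⊑ ēs L V
ēs-mono []      p = p
ēs-mono (i ∷ L) p = ⊑-ē (ēs-mono L p)

DegU-ēs⁻ : ∀ L {U K} → DegU (ēs L U) K → ∃[ K' ] (K ≡ L ++ K' × DegU U K')
DegU-ēs⁻ []      d       = _ , refl , d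
DegU-ēs⁻ (i ∷ L) (d-e d) with DegU-ēs⁻ L d
... | K' , refl , d' = K' , refl , d'

DegU-ēs-T⁺ : ∀ L {T} → WfT T → DegU (ēs L ⌜ T ⌝) L
DegU-ēs-T⁺ []      w = d-T w
DegU-ēs-T⁺ (i ∷ L) w = d-e (DegU-ēs-T⁺ L w)

DegU-ēs-T⁻ : ∀ L {T K} → DegU (ēs L ⌜ T ⌝) K → K ≡ L × WfT T
DegU-ēs-T⁻ L d with DegU-ēs⁻ L d
... | _ , refl , d-T w = ++-identityʳ L , w

-- A left inverse of every ē i; on types of degree ⊘ it is the identity.
un : TyU → TyU
un ⌜ T ⌝       = ⌜ T ⌝
un (ω [])      = ω []
un (ω (_ ∷ L)) = ω L
un (U ⊓ V)     = un U ⊓ un V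
un (ē _ U)     = U

un-DegU : ∀ {U i L} → DegU U (i ∷ L) → DegU (un U) L
un-DegU (d-ω _)    = d-ω _
un-DegU (d-⊓ d d') = d-⊓ (un-DegU d) (un-DegU d')
un-DegU (d-e d)    = d

un-DegU-[] : ∀ {U} → DegU U [] → DegU (un U) []
un-DegU-[] (d-T w)    = d-T w
un-DegU-[] (d-ω _)    = d-ω _
un-DegU-[] (d-⊓ d d') = d-⊓ (un-DegU-[] d) (un-DegU-[] d')

-- Only one outermost expansion is removed, so congruence under `ē` hands back its own premise and
-- the laws `ē-distr` and `ē-ω` become reflexivity.
un-≈ : ∀ {U V} → U ≈ V → un U ≈ un V
un-≈ ≈-refl        = ≈-refl
un-≈ (≈-sym p)     = ≈-sym (un-≈ p)
un-≈ (≈-trans p q) = ≈-trans (un-≈ p) (un-≈ q)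
un-≈ (≈-⊓ p q)     = ≈-⊓ (un-≈ p) (un-≈ q)
un-≈ (≈-ē p)       = p
un-≈ (≈-⇒ p q)     = ≈-⇒ p q
un-≈ ⊓-comm        = ⊓-comm
un-≈ ⊓-assoc       = ⊓-assoc
un-≈ ⊓-idem        = ⊓-idem
un-≈ ē-distr       = ≈-refl
un-≈ (ω-unit {L = []} d)    = ω-unit (un-DegU-[] d)
un-≈ (ω-unit {L = _ ∷ _} d) = ω-unit (un-DegU d)
un-≈ ē-ω           = ≈-refl

un-⊑ : ∀ {U V} → U ⊑ V → un U ⊑ un V
un-⊑ (⊑-≈ p)       = ⊑-≈ (un-≈ p)
un-⊑ (⊑-trans p q) = ⊑-trans (un-⊑ p) (un-⊑ q)
un-⊑ (⊑-⊓ᵉ {L = []} d d')    = ⊑-⊓ᵉ (un-DegU-[] d) (un-DegU-[] d')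
un-⊑ (⊑-⊓ᵉ {L = _ ∷ _} d d') = ⊑-⊓ᵉ (un-DegU d) (un-DegU d')
un-⊑ (⊑-⊓ p q)     = ⊑-⊓ (un-⊑ p) (un-⊑ q)
un-⊑ (⊑-⇒ p q)     = ⊑-⇒ p q
un-⊑ (⊑-ē p)       = p

-- Types of 𝕋 have degree ⊘, so a type whose degree starts with `i` is an intersection of expansions
-- by `i` and of `ω`s, and `un` strips exactly that `i`.
ē-un : ∀ {U i L} → DegU U (i ∷ L) → ē i (un U) ≈ U
ē-un (d-ω _)    = ē-ω
ē-un (d-⊓ d d') = ≈-trans ē-distr (≈-⊓ (ē-un d) (ē-un d'))
ē-un (d-e d)    = ≈-refl

-- Expansions are peeled off along `L` with `un`. At a β-redex this puts the type found for the
-- argument under the degree of the function body.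
ēs-surjective : ∀ L {V K} → DegU V (L ++ K) → ∃[ U ] ēs L U ≈ V
ēs-surjective []      d = _ , ≈-refl
ēs-surjective (i ∷ L) d with ēs-surjective L (un-DegU d)
... | U , p = U , ≈-trans (≈-ē p) (ē-un d)

-- Free variables, swapping, α-equivalence and lifting

fv-lam⁺ : ∀ {v x K} M → v ∈ fv M → v ≢ (x , K) → v ∈ fv (lam x K M)
fv-lam⁺ M = ∈-filter⁺ (λ v → ¬? (v ≟ᵥ _))

fv-lam⁻ : ∀ {v x K} M → v ∈ fv (lam x K M) → v ∈ fv M × v ≢ (x , K)
fv-lam⁻ M = ∈-filter⁻ (λ v → ¬? (v ≟ᵥ _)) {xs = fv M}

fv-fresh : ∀ {v z x K} M → z ∉ fv (lam x K M) → v ∈ fv M → v ≢ (x , K) → v ≢ z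
fv-fresh M z∉ v∈ v≢x refl = z∉ (fv-lam⁺ M v∈ v≢x)

swapᵥ-left : ∀ a b → swapᵥ a b a ≡ b
swapᵥ-left a b with a ≟ᵥ a | a ≟ᵥ b
... | yes _ | _ = refl
... | no ¬p | _ = ⊥-elim (¬p refl)

swapᵥ-right : ∀ a b → swapᵥ a b b ≡ a
swapᵥ-right a b with b ≟ᵥ a | b ≟ᵥ b
... | yes p | _     = p
... | no _  | yes _ = refl
... | no _  | no ¬p = ⊥-elim (¬p refl)

swapᵥ-other : ∀ {a b v} → v ≢ a → v ≢ b → swapᵥ a b v ≡ v
swapᵥ-other {a} {b} {v} v≢a v≢b with v ≟ᵥ a | v ≟ᵥ b
... | yes p | _     = ⊥-elim (v≢a p)
... | no _  | yes p = ⊥-elim (v≢b p)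
... | no _  | no _  = refl

swapᵥ-involutive : ∀ a b v → swapᵥ a b (swapᵥ a b v) ≡ v
swapᵥ-involutive a b v with v ≟ᵥ a | v ≟ᵥ b
... | yes refl | _        = swapᵥ-right a b
... | no _     | yes refl = swapᵥ-left a b
... | no v≢a   | no v≢b   = swapᵥ-other v≢a v≢b

swapᵥ-injective : ∀ a b {v w} → swapᵥ a b v ≡ swapᵥ a b w → v ≡ w
swapᵥ-injective a b {v} {w} p =
  trans (sym (swapᵥ-involutive a b v)) (trans (cong (swapᵥ a b) p) (swapᵥ-involutive a b w))

-- Bound variables are renamed only within one index, so that renaming changes neither degrees nor
-- gradedness.
swapᵥ-index : ∀ {x z L} v → proj₂ (swapᵥ (x , L) (z , L) v) ≡ proj₂ v
swapᵥ-index {x} {z} {L} v with v ≟ᵥ (x , L) | v ≟ᵥ (z , L)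
... | yes refl | _        = refl
... | no _     | yes refl = refl
... | no _     | no _     = refl

swap-involutive : ∀ a b M → swap a b (swap a b M) ≡ M
swap-involutive a b (var x L) =
  cong (λ v → var (proj₁ v) (proj₂ v)) (swapᵥ-involutive a b (x , L))
swap-involutive a b (app M N) = cong₂ app (swap-involutive a b M) (swap-involutive a b N)
swap-involutive a b (lam x L M) =
  cong₂ (λ v → lam (proj₁ v) (proj₂ v)) (swapᵥ-involutive a b (x , L)) (swap-involutive a b M)

fv-swap⁺ : ∀ a b M {v} → v ∈ fv M → swapᵥ a b v ∈ fv (swap a b M)
fv-swap⁺ a b (var x L) (here refl) = here refl
fv-swap⁺ a b (app M N) v∈ with ∈-++⁻ (fv M) v∈
... | inj₁ p = ∈-++⁺ˡ (fv-swap⁺ a b M p)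
... | inj₂ p = ∈-++⁺ʳ (fv (swap a b M)) (fv-swap⁺ a b N p)
fv-swap⁺ a b (lam x L M) v∈ with fv-lam⁻ M v∈
... | v∈M , v≢x = fv-lam⁺ (swap a b M) (fv-swap⁺ a b M v∈M) (λ p → v≢x (swapᵥ-injective a b p))

fv-swap⁻ : ∀ a b M {v} → v ∈ fv (swap a b M) → swapᵥ a b v ∈ fv M
fv-swap⁻ a b M {v} v∈ =
  subst (λ N → swapᵥ a b v ∈ fv N) (swap-involutive a b M) (fv-swap⁺ a b (swap a b M) v∈)

=α-sym : ∀ {M N} → M =α N → N =α M
=α-sym (α-var x L)   = α-var x L
=α-sym (α-app p q)   = α-app (=α-sym p) (=α-sym q)
=α-sym (α-lam a b p) = α-lam b a (=α-sym p)

=α-fv : ∀ {M N v} → M =α N → v ∈ fv M → v ∈ fv N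
=α-fv (α-var x L) v∈ = v∈
=α-fv (α-app {M} {M'} p q) v∈ with ∈-++⁻ (fv M) v∈
... | inj₁ r = ∈-++⁺ˡ (=α-fv p r)
... | inj₂ r = ∈-++⁺ʳ (fv M') (=α-fv q r)
=α-fv {v = v} (α-lam {x} {y} {z} {L} {M} {N} z∉M z∉N p) v∈ with fv-lam⁻ M v∈
... | v∈M , v≢x = body
  where
  v≢z : v ≢ (z , L)
  v≢z = fv-fresh M z∉M v∈M v≢x

  swapped : swapᵥ (y , L) (z , L) v ∈ fv N
  swapped = fv-swap⁻ _ _ N (=α-fv p
    (subst (_∈ fv (swap (x , L) (z , L) M)) (swapᵥ-other v≢x v≢z) (fv-swap⁺ _ _ M v∈M)))

  body : v ∈ fv (lam y L N)
  body with v ≟ᵥ (y , L)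
  -- If `v` were the binder `y`, the swap would send it to `z`, which would then be free in `N`
  -- against its freshness.
  ... | yes refl = ⊥-elim (fv-fresh N z∉N (subst (_∈ fv N) (swapᵥ-left v (z , L)) swapped)
                             (λ z≡y → v≢z (sym z≡y)) refl)
  ... | no v≢y   = fv-lam⁺ N (subst (_∈ fv N) (swapᵥ-other v≢y v≢z) swapped) v≢y

-- Degrees and gradedness of raw terms

deg : Λ → Index
deg (var x L)   = L
deg (app M N)   = deg M
deg (lam x L M) = deg M

Tm-deg : ∀ {M L} → Tm M L → deg M ≡ L
Tm-deg (tvar x L)     = refl
Tm-deg (tapp t _ _ _) = Tm-deg t
Tm-deg (tlam t _)     = Tm-deg t

deg-swap : ∀ {x z L} M → deg (swap (x , L) (z , L) M) ≡ deg M
deg-swap (var y K)   = swapᵥ-index (y , K)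
deg-swap (app M N)   = deg-swap M
deg-swap (lam y K M) = deg-swap M

deg-=α : ∀ {M N} → M =α N → deg M ≡ deg N
deg-=α (α-var x L) = refl
deg-=α (α-app p q) = deg-=α p
deg-=α (α-lam {M = M} {N = N} _ _ p) = trans (sym (deg-swap M)) (trans (deg-=α p) (deg-swap N))

deg-lift : ∀ j M → deg (lift j M) ≡ j ∷ deg M
deg-lift j (var x L)   = refl
deg-lift j (app M N)   = deg-lift j M
deg-lift j (lam x L M) = deg-lift j M

-- The part of membership in 𝓜 that, unlike joinability of raw terms, is invariant under =α.
Graded : Λ → Set
Graded (var x L)   = ⊤
Graded (app M N)   = Graded M × Graded N
Graded (lam x L M) = deg M ⪯ L × Graded M

Tm-Graded : ∀ {M L} → Tm M L → Graded M
Tm-Graded (tvar x L)     = tt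
Tm-Graded (tapp s t _ _) = Tm-Graded s , Tm-Graded t
Tm-Graded (tlam t p) with refl ← Tm-deg t = p , Tm-Graded t

Graded-swap : ∀ {x z L} M → Graded M → Graded (swap (x , L) (z , L) M)
Graded-swap (var y K)   g        = tt
Graded-swap (app M N)   (g , h)  = Graded-swap M g , Graded-swap N h
Graded-swap {x} {z} {L} (lam y K M) ((K' , p) , g)
  rewrite deg-swap {x} {z} {L} M | swapᵥ-index {x} {z} {L} (y , K) = (K' , p) , Graded-swap M g

Graded-swap⁻ : ∀ {x z L} M → Graded (swap (x , L) (z , L) M) → Graded M
Graded-swap⁻ M g = subst Graded (swap-involutive _ _ M) (Graded-swap (swap _ _ M) g)

Graded-=α : ∀ {M N} → M =α N → Graded M → Graded N
Graded-=α (α-var x L) g       = tt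
Graded-=α (α-app p q) (g , h) = Graded-=α p g , Graded-=α q h
Graded-=α (α-lam {L = L} {M} {N} a b p) (q , g) =
  subst (_⪯ L) (deg-=α (α-lam a b p)) q , Graded-swap⁻ N (Graded-=α p (Graded-swap M g))

-- Degrees, gradedness and free variables along substitution and reduction

deg-Subst : ∀ {M v N P} → deg N ≡ proj₂ v → Subst M v N P → deg P ≡ deg M
deg-Subst e (s-var≡ refl) = e
deg-Subst e (s-var≢ _)    = refl
deg-Subst e (s-app s _)   = deg-Subst e s
deg-Subst e (s-lam≡ _)    = refl
deg-Subst e (s-lam≢ {M = M} _ _ _ _ s) = trans (deg-Subst e s) (deg-swap M)

Graded-Subst : ∀ {M v N P} → deg N ≡ proj₂ v → Graded N → Subst M v N P → Graded M → Graded P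
Graded-Subst e n (s-var≡ _)  g       = n
Graded-Subst e n (s-var≢ _)  g       = tt
Graded-Subst e n (s-app s t) (g , h) = Graded-Subst e n s g , Graded-Subst e n t h
Graded-Subst e n (s-lam≡ _)  g       = g
Graded-Subst e n (s-lam≢ {K = K} {M = M} _ _ _ _ s) (q , g) =
  subst (_⪯ K) (sym (trans (deg-Subst e s) (deg-swap M))) q , Graded-Subst e n s (Graded-swap M g)

fv-Subst : ∀ {M v N P w} → Subst M v N P → w ∈ fv P → (w ∈ fv M × w ≢ v) ⊎ w ∈ fv N
fv-Subst (s-var≡ _) w∈ = inj₂ w∈
fv-Subst (s-var≢ x≢v) (here refl) = inj₁ (here refl , x≢v)
fv-Subst (s-app {M₁ = M₁} {P₁ = P₁} s t) w∈ with ∈-++⁻ (fv P₁) w∈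
fv-Subst (s-app {M₁ = M₁} s t) w∈ | inj₁ p with fv-Subst s p
... | inj₁ (q , w≢v) = inj₁ (∈-++⁺ˡ q , w≢v)
... | inj₂ q         = inj₂ q
fv-Subst (s-app {M₁ = M₁} s t) w∈ | inj₂ p with fv-Subst t p
... | inj₁ (q , w≢v) = inj₁ (∈-++⁺ʳ (fv M₁) q , w≢v)
... | inj₂ q         = inj₂ q
fv-Subst (s-lam≡ {M = M} refl) w∈ = inj₁ (w∈ , proj₂ (fv-lam⁻ M w∈))
fv-Subst {w = w} (s-lam≢ {y} {z} {K} {M} {v} {N} {P} y≢v z∉M z∉N z≢v s) w∈ with fv-lam⁻ P w∈
... | w∈P , w≢z with fv-Subst s w∈P
...   | inj₂ q = inj₂ q
...   | inj₁ (q , w≢v) with w ≟ᵥ (y , K)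
...     | yes refl = ⊥-elim (fv-fresh M z∉M
                       (subst (_∈ fv M) (swapᵥ-left w (z , K)) (fv-swap⁻ _ _ M q))
                       (λ z≡y → w≢z (sym z≡y)) refl)
...     | no w≢y   = inj₁ (fv-lam⁺ M
                       (subst (_∈ fv M) (swapᵥ-other w≢y w≢z) (fv-swap⁻ _ _ M q)) w≢y , w≢v)

deg-▷β : ∀ {M N} → M ▷β N → deg N ≡ deg M
deg-▷β (β t _ s)  = deg-Subst (Tm-deg t) s
deg-▷β (▷-appˡ r) = deg-▷β r
deg-▷β (▷-appʳ r) = refl
deg-▷β (▷-lam r)  = deg-▷β r

Graded-▷β : ∀ {M N} → M ▷β N → Graded M → Graded N
Graded-▷β (β t _ s)  ((_ , g) , h) = Graded-Subst (Tm-deg t) h s g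
Graded-▷β (▷-appˡ r) (g , h)       = Graded-▷β r g , h
Graded-▷β (▷-appʳ r) (g , h)       = g , Graded-▷β r h
Graded-▷β (▷-lam {L = L} r) (q , g) = subst (_⪯ L) (sym (deg-▷β r)) q , Graded-▷β r g

fv-▷β : ∀ {M N v} → M ▷β N → v ∈ fv N → v ∈ fv M
fv-▷β (β {x} {L} {M} _ _ s) v∈ with fv-Subst s v∈
... | inj₁ (p , v≢x) = ∈-++⁺ˡ (fv-lam⁺ M p v≢x)
... | inj₂ p         = ∈-++⁺ʳ (fv (lam x L M)) p
fv-▷β (▷-appˡ {M} {M'} r) v∈ with ∈-++⁻ (fv M') v∈
... | inj₁ p = ∈-++⁺ˡ (fv-▷β r p)
... | inj₂ p = ∈-++⁺ʳ (fv M) p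
fv-▷β (▷-appʳ {M} r) v∈ with ∈-++⁻ (fv M) v∈
... | inj₁ p = ∈-++⁺ˡ p
... | inj₂ p = ∈-++⁺ʳ (fv M) (fv-▷β r p)
fv-▷β (▷-lam {M = M} {M' = M'} r) v∈ with fv-lam⁻ M' v∈
... | p , v≢x = fv-lam⁺ M (fv-▷β r p) v≢x

deg-▷β* : ∀ {M N} → M ▷β* N → deg N ≡ deg M
deg-▷β* (▷*-α p)       = sym (deg-=α p)
deg-▷β* (▷*-step r s)  = trans (deg-▷β* s) (deg-▷β r)
deg-▷β* (▷*-αstep p s) = trans (deg-▷β* s) (sym (deg-=α p))

-- Reduction may erase free variables but creates none. An environment typing `N` has domain `fv N`,
-- so `Γ ↑ M` adds just the erased variables.
fv-▷β* : ∀ {M N v} → M ▷β* N → v ∈ fv N → v ∈ fv M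
fv-▷β* (▷*-α p)       v∈ = =α-fv (=α-sym p) v∈
fv-▷β* (▷*-step r s)  v∈ = fv-▷β r (fv-▷β* s v∈)
fv-▷β* (▷*-αstep p s) v∈ = =α-fv (=α-sym p) (fv-▷β* s v∈)

-- Lifting and its inverse

liftᵥ : ℕ → Var → Var
liftᵥ j (x , L) = x , j ∷ L

fv-lift⁺ : ∀ j M {v} → v ∈ fv M → liftᵥ j v ∈ fv (lift j M)
fv-lift⁺ j (var x L) (here refl) = here refl
fv-lift⁺ j (app M N) v∈ with ∈-++⁻ (fv M) v∈
... | inj₁ p = ∈-++⁺ˡ (fv-lift⁺ j M p)
... | inj₂ p = ∈-++⁺ʳ (fv (lift j M)) (fv-lift⁺ j N p)
fv-lift⁺ j (lam x L M) v∈ with fv-lam⁻ M v∈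
... | p , v≢x = fv-lam⁺ (lift j M) (fv-lift⁺ j M p) λ { refl → v≢x refl }

fv-lift⁻ : ∀ j M {w} → w ∈ fv (lift j M) → ∃[ v ] (w ≡ liftᵥ j v × v ∈ fv M)
fv-lift⁻ j (var x L) (here refl) = _ , refl , here refl
fv-lift⁻ j (app M N) w∈ with ∈-++⁻ (fv (lift j M)) w∈
fv-lift⁻ j (app M N) w∈ | inj₁ p with fv-lift⁻ j M p
... | v , e , q = v , e , ∈-++⁺ˡ q
fv-lift⁻ j (app M N) w∈ | inj₂ p with fv-lift⁻ j N p
... | v , e , q = v , e , ∈-++⁺ʳ (fv M) q
fv-lift⁻ j (lam x L M) w∈ with fv-lam⁻ (lift j M) w∈
... | p , w≢x with fv-lift⁻ j M p
...   | v , refl , q = v , refl , fv-lam⁺ M q λ { refl → w≢x refl }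

-- In 𝓜 an argument has a degree extending that of its function, and a binder an index extending the
-- degree of its body. A degree starting with `i` therefore forces every index in the term to start
-- with `i`.
Tm-lift⁻ : ∀ {M i L} → Tm M (i ∷ L) → ∃[ M₀ ] (M ≡ lift i M₀ × Tm M₀ L)
Tm-lift⁻ (tvar x (i ∷ L)) = var x L , refl , tvar x L
Tm-lift⁻ {i = i} (tapp s t (K , refl) j) with Tm-lift⁻ s | Tm-lift⁻ t
... | M₀ , refl , s₀ | N₀ , refl , t₀ = app M₀ N₀ , refl , tapp s₀ t₀ (K , refl)
  (λ x L K p q → ∷-injectiveʳ (j x (i ∷ L) (i ∷ K) (fv-lift⁺ i M₀ p) (fv-lift⁺ i N₀ q)))
Tm-lift⁻ (tlam t (K , refl)) with Tm-lift⁻ t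
... | M₀ , refl , t₀ = lam _ _ M₀ , refl , tlam t₀ (K , refl)

-- Total contexts

Ctx : Set
Ctx = Var → TyU

_[_≔_] : Ctx → Var → TyU → Ctx
(σ [ v ≔ U ]) w with w ≟ᵥ v
... | yes _ = U
... | no _  = σ w

≔-hit : ∀ σ v {U} → (σ [ v ≔ U ]) v ≡ U
≔-hit σ v with v ≟ᵥ v
... | yes _ = refl
... | no ¬p = ⊥-elim (¬p refl)

≔-miss : ∀ σ {v U w} → w ≢ v → (σ [ v ≔ U ]) w ≡ σ w
≔-miss σ {v} {w = w} w≢v with w ≟ᵥ v
... | yes p = ⊥-elim (w≢v p)
... | no _  = refl

GradedCtx : Ctx → Set
GradedCtx σ = ∀ v → DegU (σ v) (proj₂ v)

≔-graded : ∀ {σ v U} → GradedCtx σ → DegU U (proj₂ v) → GradedCtx (σ [ v ≔ U ])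
≔-graded {v = v} g d w with w ≟ᵥ v
... | yes refl = d
... | no _     = g w

-- U is ≈ to an intersection of types ēs K ⌜ T ⌝; Each P L U says that P (L ++ K) T for all of them.
Each : (Index → TyT → Set) → Index → TyU → Set
Each P L ⌜ T ⌝   = P L T
Each P L (ω _)   = ⊤
Each P L (U ⊓ V) = Each P L U × Each P L V
Each P L (ē i U) = Each P (L ++ i ∷ []) U

Each-map : ∀ {P Q : Index → TyT → Set} → (∀ {L T} → P L T → Q L T) →
           ∀ {L} U → Each P L U → Each Q L U
Each-map f ⌜ T ⌝   p       = f p
Each-map f (ω _)   p       = tt
Each-map f (U ⊓ V) (p , q) = Each-map f U p , Each-map f V q
Each-map f (ē i U) p       = Each-map f U p

Each-shift : ∀ {P Q : Index → TyT → Set} {j} → (∀ {L T} → P L T → Q (j ∷ L) T) →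
             ∀ {L} U → Each P L U → Each Q (j ∷ L) U
Each-shift f ⌜ T ⌝   p       = f p
Each-shift f (ω _)   p       = tt
Each-shift f (U ⊓ V) (p , q) = Each-shift f U p , Each-shift f V q
Each-shift f (ē i U) p       = Each-shift f U p

Each-unshift : ∀ {P Q : Index → TyT → Set} {j} → (∀ {L T} → P (j ∷ L) T → Q L T) →
               ∀ {L} U → Each P (j ∷ L) U → Each Q L U
Each-unshift f ⌜ T ⌝   p       = f p
Each-unshift f (ω _)   p       = tt
Each-unshift f (U ⊓ V) (p , q) = Each-unshift f U p , Each-unshift f V q
Each-unshift f (ē i U) p       = Each-unshift f U p

Each-ēs⁺ : ∀ {P} L K {U} → Each P (L ++ K) U → Each P L (ēs K U)
Each-ēs⁺ {P} L []      {U} p = subst (λ L' → Each P L' U) (++-identityʳ L) p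
Each-ēs⁺ {P} L (i ∷ K) {U} p =
  Each-ēs⁺ (L ++ i ∷ []) K (subst (λ L' → Each P L' U) (sym (++-assoc L (i ∷ []) K)) p)

Each-ēs⁻ : ∀ {P} L K {U} → Each P L (ēs K U) → Each P (L ++ K) U
Each-ēs⁻ {P} L []      {U} p = subst (λ L' → Each P L' U) (sym (++-identityʳ L)) p
Each-ēs⁻ {P} L (i ∷ K) {U} p =
  subst (λ L' → Each P L' U) (++-assoc L (i ∷ []) K) (Each-ēs⁻ (L ++ i ∷ []) K p)

-- Has M σ L T is the syntax-directed form of M : ⟨ σ ⊢ ēs L ⌜ T ⌝ ⟩.
Has : Λ → Ctx → Index → TyT → Set
Has (var x K)   σ L T        = σ (x , K) ⊑ ēs L ⌜ T ⌝
Has (app M N)   σ L T        =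
  Σ TyU λ U → DegU (ēs L U) (deg N) × Has M σ L (U ⇒ T) × Each (Has N σ) L U
Has (lam x K M) σ L (atom a) = ⊥
Has (lam x K M) σ L (U ⇒ T)  = DegU (ēs L U) K × Has M (σ [ x , K ≔ ēs L U ]) L T

-- A variable passes its index on to its type, an application takes its degree from the function and
-- an abstraction from the body; so the subject determines the prefix `L`.
Has-graded : ∀ M {σ L T} → GradedCtx σ → Has M σ L T → deg M ≡ L × WfT T
Has-graded (var x K)   {L = L} g p = DegU-ēs-T⁻ L (DegU-⊑⇒ p (g (x , K)))
Has-graded (app M N)   g (U , _ , p , _) with Has-graded M g p
... | e , wf-⇒ _ w = e , w
Has-graded (lam x K M) {L = L} {T = U ⇒ T} g (d , p) with Has-graded M (≔-graded g d) p | DegU-ēs⁻ L d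
... | e , w | _ , _ , d' = e , wf-⇒ d' w

-- Stronger assumptions enter at the variables, by transitivity. As only free variables are
-- compared, this covers weakening and strengthening too.
Has-mono : ∀ M {σ τ L T} → (∀ {v} → v ∈ fv M → σ v ⊑ τ v) → Has M τ L T → Has M σ L T
Has-mono (var x K)   h p = ⊑-trans (h (here refl)) p
Has-mono (app M N)   h (U , d , p , q) =
  U , d , Has-mono M (λ v∈ → h (∈-++⁺ˡ v∈)) p
    , Each-map (Has-mono N (λ v∈ → h (∈-++⁺ʳ (fv M) v∈))) U q
Has-mono (lam x K M) {σ} {τ} {L} {U ⇒ T} h (d , p) = d , Has-mono M under p
  where
  under : ∀ {v} → v ∈ fv M → (σ [ x , K ≔ ēs L U ]) v ⊑ (τ [ x , K ≔ ēs L U ]) v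
  under {v} v∈ with v ≟ᵥ (x , K)
  ... | yes _  = ⊑-refl
  ... | no v≢x = h (fv-lam⁺ M v∈ v≢x)

≔-⊑ : ∀ σ v {U V} → U ⊑ V → ∀ w → (σ [ v ≔ U ]) w ⊑ (σ [ v ≔ V ]) w
≔-⊑ σ v p w with w ≟ᵥ v
... | yes _ = p
... | no _  = ⊑-refl

-- The hypothesis compares values on `fv M` only, so renaming and change of context happen at once
-- and contexts need not be equal as functions.
Has-swap : ∀ M {x z K σ τ L T} → (∀ {v} → v ∈ fv M → σ (swapᵥ (x , K) (z , K) v) ⊑ τ v) →
           Has M τ L T → Has (swap (x , K) (z , K) M) σ L T
Has-swap (var y J)   h p = ⊑-trans (h (here refl)) p
Has-swap (app M N)   h (U , d , p , q) =
  U , subst (DegU _) (sym (deg-swap N)) d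
    , Has-swap M (λ v∈ → h (∈-++⁺ˡ v∈)) p
    , Each-map (Has-swap N (λ v∈ → h (∈-++⁺ʳ (fv M) v∈))) U q
Has-swap (lam y J M) {x} {z} {K} {σ} {τ} {L} {U ⇒ T} h (d , p) =
  subst (DegU _) (sym (swapᵥ-index (y , J))) d , Has-swap M under p
  where
  π : Var → Var
  π = swapᵥ (x , K) (z , K)

  under : ∀ {v} → v ∈ fv M → (σ [ π (y , J) ≔ ēs L U ]) (π v) ⊑ (τ [ y , J ≔ ēs L U ]) v
  under {v} v∈ with v ≟ᵥ (y , J)
  ... | yes refl = ⊑-reflexive (≔-hit σ (π (y , J)))
  ... | no v≢y   = ⊑-trans (⊑-reflexive (≔-miss σ (λ e → v≢y (swapᵥ-injective _ _ e))))
                           (h (fv-lam⁺ M v∈ v≢y))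

Has-unswap : ∀ M {x z K σ τ L T} → (∀ {v} → v ∈ fv M → τ v ⊑ σ (swapᵥ (x , K) (z , K) v)) →
             Has (swap (x , K) (z , K) M) σ L T → Has M τ L T
Has-unswap M {x} {z} {K} {σ} {τ} h p =
  subst (λ N → Has N τ _ _) (swap-involutive _ _ M) (Has-swap (swap _ _ M) flipped p)
  where
  flipped : ∀ {v} → v ∈ fv (swap (x , K) (z , K) M) → τ (swapᵥ (x , K) (z , K) v) ⊑ σ v
  flipped v∈ = ⊑-trans (h (fv-swap⁻ _ _ M v∈)) (⊑-reflexive (cong σ (swapᵥ-involutive _ _ _)))

≔-swap : ∀ M {x z K σ U v} → (z , K) ∉ fv (lam x K M) → v ∈ fv M →
         (σ [ z , K ≔ U ]) (swapᵥ (x , K) (z , K) v) ≡ (σ [ x , K ≔ U ]) v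
≔-swap M {x} {z} {K} {σ} {v = v} z∉ v∈ with toSum (v ≟ᵥ (x , K))
... | inj₁ refl = trans (cong (σ [ z , K ≔ _ ]) (swapᵥ-left (x , K) (z , K)))
                    (trans (≔-hit σ (z , K)) (sym (≔-hit σ (x , K))))
... | inj₂ v≢x  = trans (cong (σ [ z , K ≔ _ ]) (swapᵥ-other v≢x v≢z))
                    (trans (≔-miss σ v≢z) (sym (≔-miss σ v≢x)))
  where v≢z = fv-fresh M z∉ v∈ v≢x

Has-=α : ∀ {M N σ L T} → M =α N → Has M σ L T → Has N σ L T
Has-=α (α-var x L) p = p
Has-=α (α-app p q) (U , d , r , s) =
  U , subst (DegU _) (deg-=α q) d , Has-=α p r , Each-map (Has-=α q) U s
Has-=α {σ = σ} {L} {U ⇒ T} (α-lam {z = z} {K} {M} {N} z∉M z∉N p) (d , r) =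
  -- Both bodies are renamed to the common fresh `z`: the type of the bound variable moves from `x`
  -- to `z`, crosses `p`, and moves on to `y`.
  d , Has-unswap N (λ v∈ → ⊑-reflexive (sym (≔-swap N {σ = σ} {ēs L U} z∉N v∈)))
        (Has-=α {σ = σ [ z , K ≔ ēs L U ]} p (Has-swap M (λ v∈ → ⊑-reflexive (≔-swap M {σ = σ} {ēs L U} z∉M v∈)) r))

-- Subtyping is admissible

mutual
  -- Apart from arrows, the rules only rearrange the components collected by `Each`. Arrows need
  -- `Has-⇒`, which recurs only on proper subterms; this makes the recursion terminate although
  -- derivations may grow there.
  Has-⊑ : ∀ M {σ L U V} → U ⊑ V → Each (Has M σ) L U → Each (Has M σ) L V
  Has-⊑ M (⊑-≈ p)       h       = Has-≈⇒ M p h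
  Has-⊑ M (⊑-trans p q) h       = Has-⊑ M q (Has-⊑ M p h)
  Has-⊑ M (⊑-⊓ᵉ _ _)    (h , _) = h
  Has-⊑ M (⊑-⊓ p q)     (h , k) = Has-⊑ M p h , Has-⊑ M q k
  Has-⊑ M (⊑-⇒ p q)     h       = Has-⇒ M p q h
  Has-⊑ M (⊑-ē p)       h       = Has-⊑ M p h

  Has-≈⇒ : ∀ M {σ L U V} → U ≈ V → Each (Has M σ) L U → Each (Has M σ) L V
  Has-≈⇒ M ≈-refl        h             = h
  Has-≈⇒ M (≈-sym p)     h             = Has-≈⇐ M p h
  Has-≈⇒ M (≈-trans p q) h             = Has-≈⇒ M q (Has-≈⇒ M p h)
  Has-≈⇒ M (≈-⊓ p q)     (h , k)       = Has-≈⇒ M p h , Has-≈⇒ M q k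
  Has-≈⇒ M (≈-ē p)       h             = Has-≈⇒ M p h
  Has-≈⇒ M (≈-⇒ p q)     h             = Has-⇒ M (⊑-≈ (≈-sym p)) (⊑-≈ q) h
  Has-≈⇒ M ⊓-comm        (h , k)       = k , h
  Has-≈⇒ M ⊓-assoc       ((h , k) , l) = h , k , l
  Has-≈⇒ M ⊓-idem        (h , _)       = h
  Has-≈⇒ M ē-distr       h             = h
  Has-≈⇒ M (ω-unit _)    (_ , h)       = h
  Has-≈⇒ M ē-ω           h             = tt

  Has-≈⇐ : ∀ M {σ L U V} → U ≈ V → Each (Has M σ) L V → Each (Has M σ) L U
  Has-≈⇐ M ≈-refl        h             = h
  Has-≈⇐ M (≈-sym p)     h             = Has-≈⇒ M p h
  Has-≈⇐ M (≈-trans p q) h             = Has-≈⇐ M p (Has-≈⇐ M q h)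
  Has-≈⇐ M (≈-⊓ p q)     (h , k)       = Has-≈⇐ M p h , Has-≈⇐ M q k
  Has-≈⇐ M (≈-ē p)       h             = Has-≈⇐ M p h
  Has-≈⇐ M (≈-⇒ p q)     h             = Has-⇒ M (⊑-≈ p) (⊑-≈ (≈-sym q)) h
  Has-≈⇐ M ⊓-comm        (h , k)       = k , h
  Has-≈⇐ M ⊓-assoc       (h , k , l)   = (h , k) , l
  Has-≈⇐ M ⊓-idem        h             = h , h
  Has-≈⇐ M ē-distr       h             = h
  Has-≈⇐ M (ω-unit _)    h             = tt , h
  Has-≈⇐ M ē-ω           h             = tt

  -- A variable absorbs the step by transitivity, an application pushes it into the target of its
  -- function's type, and an abstraction turns the domain half into a stronger declaration and
  -- leaves the target half to its body.
  Has-⇒ : ∀ M {σ L U₁ U₂ T₁ T₂} → U₂ ⊑ U₁ → ⌜ T₁ ⌝ ⊑ ⌜ T₂ ⌝ →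
          Has M σ L (U₁ ⇒ T₁) → Has M σ L (U₂ ⇒ T₂)
  Has-⇒ (var x K)   {L = L} p q h = ⊑-trans h (ēs-mono L (⊑-⇒ p q))
  Has-⇒ (app M N)   p q (U , d , h , k) = U , d , Has-⇒ M ⊑-refl (⊑-⇒ p q) h , k
  Has-⇒ (lam x K M) {σ} {L} p q (d , h) =
    DegU-⊑⇐ (ēs-mono L p) d ,
    Has-⊑ M q (Has-mono M (λ {v} _ → ≔-⊑ σ (x , K) (ēs-mono L p) v) h)

-- Lifting

unᶜ : ℕ → Ctx → Ctx
unᶜ j σ v = un (σ (liftᵥ j v))

unᶜ-graded : ∀ {j σ} → GradedCtx σ → GradedCtx (unᶜ j σ)
unᶜ-graded {j} g v = un-DegU (g (liftᵥ j v))

unᶜ-≔ : ∀ j σ v {U} w → unᶜ j (σ [ liftᵥ j v ≔ ē j U ]) w ≡ (unᶜ j σ [ v ≔ U ]) w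
unᶜ-≔ j σ v w with w ≟ᵥ v
... | yes refl = cong un (≔-hit σ (liftᵥ j v))
... | no w≢v   = cong un (≔-miss σ λ { refl → w≢v refl })

-- Grading makes the degree of the type of a lifted variable start with `j`, so by `ē-un` nothing is
-- lost in `unᶜ j σ`.
Has-lift⁺ : ∀ j M {σ L T} → GradedCtx σ → Has M (unᶜ j σ) L T → Has (lift j M) σ (j ∷ L) T
Has-lift⁺ j (var x K)   g p = ⊑-trans (⊑-≈ (≈-sym (ē-un (g (x , j ∷ K))))) (⊑-ē p)
Has-lift⁺ j (app M N)   g (U , d , p , q) =
  U , subst (DegU _) (sym (deg-lift j N)) (d-e d)
    , Has-lift⁺ j M g p , Each-shift (Has-lift⁺ j N g) U q
Has-lift⁺ j (lam x K M) {σ} {T = U ⇒ T} g (d , p) =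
  d-e d , Has-lift⁺ j M (≔-graded g (d-e d))
            (Has-mono M (λ {v} _ → ⊑-reflexive (unᶜ-≔ j σ (x , K) v)) p)

Has-lift⁻ : ∀ j M {σ L T} → Has (lift j M) σ (j ∷ L) T → Has M (unᶜ j σ) L T
Has-lift⁻ j (var x K)   p = un-⊑ p
Has-lift⁻ j (app M N)   (U , d , p , q) with subst (DegU _) (deg-lift j N) d
... | d-e d' = U , d' , Has-lift⁻ j M p , Each-unshift (Has-lift⁻ j N) U q
Has-lift⁻ j (lam x K M) {σ} {T = U ⇒ T} (d-e d , p) =
  d , Has-mono M (λ {v} _ → ⊑-reflexive (sym (unᶜ-≔ j σ (x , K) v))) (Has-lift⁻ j M p)

-- Expansion

-- The types that a derivation for P = M[v := N] assigns to the copies of N are intersected into one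
-- type for v; if there is no copy, this is ω.
record SplitAt (Q : Ctx → Set) (σ : Ctx) (v : Var) (N : Λ) : Set where
  constructor split
  field
    type   : TyU
    graded : DegU type (proj₂ v)
    arg    : Each (Has N σ) [] type
    body   : Q (σ [ v ≔ type ])

-- The intersection of the two types of `v` is below each, so both halves hold in the common context
-- by monotonicity; it has a degree because both types have the index of `v` as degree.
Split-× : ∀ {Q R S : Ctx → Set} {σ v N} →
          (∀ {τ τ'} → (∀ w → τ w ⊑ τ' w) → Q τ' → Q τ) →
          (∀ {τ τ'} → (∀ w → τ w ⊑ τ' w) → R τ' → R τ) →
          (∀ {τ} → Q τ → R τ → S τ) →
          SplitAt Q σ v N → SplitAt R σ v N → SplitAt S σ v N
Split-× {σ = σ} {v} monoQ monoR pair (split V d n q) (split W e m r) =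
  split (V ⊓ W) (d-⊓ d e) (n , m)
    (pair (monoQ (≔-⊑ σ v (⊑-⊓ᵉ d e)) q) (monoR (≔-⊑ σ v (⊑-⊓ʳ d e)) r))

Split-ω : ∀ {Q : Ctx → Set} {σ v N} → Q (σ [ v ≔ ω (proj₂ v) ]) → SplitAt Q σ v N
Split-ω q = split _ (d-ω _) tt q

Each-mono : ∀ M {L} U {σ τ} → (∀ v → σ v ⊑ τ v) → Each (Has M τ) L U → Each (Has M σ) L U
Each-mono M U h = Each-map (Has-mono M (λ {v} _ → h v)) U

Split-Each : ∀ {M P σ v N} →
             (∀ {L T} → Has P σ L T → SplitAt (λ τ → Has M τ L T) σ v N) →
             ∀ {L} U → Each (Has P σ) L U → SplitAt (λ τ → Each (Has M τ) L U) σ v N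
Split-Each f ⌜ T ⌝   h       = f h
Split-Each f (ω K)   h       = Split-ω tt
Split-Each {M} f (U ⊓ V) (h , k) =
  Split-× (Each-mono M U) (Each-mono M V) _,_ (Split-Each f U h) (Split-Each f V k)
Split-Each f (ē i U) h       = Split-Each f U h

Has-Subst : ∀ {M v N P σ L T} → deg N ≡ proj₂ v → GradedCtx σ → Subst M v N P →
            Has P σ L T → SplitAt (λ τ → Has M τ L T) σ v N
Has-Subst {N = N} {σ = σ} {L} {T} e g (s-var≡ {x} {K} refl) h with Has-graded N g h
-- A copy of `N` gives `v` exactly the type that it has there; by `Has-graded` the degree of this
-- type is that of `N`, the index of `v`.
... | e' , w = split (ēs L ⌜ T ⌝) (subst (DegU _) (trans (sym e') e) (DegU-ēs-T⁺ L w))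
                     (Each-ēs⁺ [] L h) (⊑-reflexive (≔-hit σ (x , K)))
Has-Subst {σ = σ} e g (s-var≢ x≢v) h = Split-ω (⊑-trans (⊑-reflexive (≔-miss σ x≢v)) h)
Has-Subst e g (s-app {M₁} {M₂} s t) (U , d , p , q) =
  Split-× (λ h → Has-mono M₁ (λ {v} _ → h v)) (Each-mono M₂ U)
    (λ p q → U , subst (DegU _) (deg-Subst e t) d , p , q)
    (Has-Subst e g s p) (Split-Each (Has-Subst e g t) U q)
Has-Subst {σ = σ} {L} {U ⇒ T} e g (s-lam≡ {y} {K} {M} {v} refl) (d , p) =
  -- The binder shadows `v`, so no copy of `N` is inserted.
  Split-ω (d , Has-mono M (λ {w} _ → shadow w) p)
  where
  shadow : ∀ w → ((σ [ v ≔ ω K ]) [ v ≔ ēs L U ]) w ⊑ (σ [ v ≔ ēs L U ]) w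
  shadow w with w ≟ᵥ v
  ... | yes _  = ⊑-refl
  ... | no w≢v = ⊑-reflexive (≔-miss σ w≢v)
Has-Subst {σ = σ} {L} {U ⇒ T} e g (s-lam≢ {y} {z} {K} {M} {v} {N} y≢v z∉M z∉N z≢v s) (d , p)
  with Has-Subst e (≔-graded g d) s p
-- The induction hypothesis lives in the context that declares `z`. The typings of `N` leave it
-- because `z` is not free in `N`; the body returns from `z` to `y` by undoing the swap.
... | split V c n q = split V c (Each-map (Has-mono N restore) V n) (d , Has-unswap M exchange q)
  where
  restore : ∀ {w} → w ∈ fv N → σ w ⊑ (σ [ z , K ≔ ēs L U ]) w
  restore w∈ = ⊑-reflexive (sym (≔-miss σ λ { refl → z∉N w∈ }))

  exchange : ∀ {w} → w ∈ fv M → ((σ [ v ≔ V ]) [ y , K ≔ ēs L U ]) w ⊑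
             ((σ [ z , K ≔ ēs L U ]) [ v ≔ V ]) (swapᵥ (y , K) (z , K) w)
  exchange {w} w∈ with toSum (w ≟ᵥ (y , K))
  ... | inj₁ refl = ⊑-reflexive (trans (≔-hit (σ [ v ≔ V ]) w) (sym
                      (trans (cong ((σ [ z , K ≔ ēs L U ]) [ v ≔ V ]) (swapᵥ-left w (z , K)))
                        (trans (≔-miss (σ [ z , K ≔ ēs L U ]) z≢v) (≔-hit σ (z , K))))))
  ... | inj₂ w≢y  = ⊑-reflexive (trans (≔-miss (σ [ v ≔ V ]) w≢y) (trans outer
                      (cong ((σ [ z , K ≔ ēs L U ]) [ v ≔ V ]) (sym (swapᵥ-other w≢y w≢z)))))
    where
    w≢z : w ≢ (z , K)
    w≢z = fv-fresh M z∉M w∈ w≢y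

    outer : (σ [ v ≔ V ]) w ≡ ((σ [ z , K ≔ ēs L U ]) [ v ≔ V ]) w
    outer with w ≟ᵥ v
    ... | yes _ = refl
    ... | no _  = sym (≔-miss σ w≢z)

Has-▷β : ∀ {M N σ L T} → M ▷β N → Graded M → GradedCtx σ → Has N σ L T → Has M σ L T
Has-▷β {σ = σ} (β {x} {K} {M} {N} t _ s) ((q , _) , _) g h with Has-Subst (Tm-deg t) g s h
... | split V d n m with Has-graded M (≔-graded g d) m | q
... | refl , w | K' , refl with ēs-surjective (deg M) d
-- `V` has degree `deg M ++ K'`, so it is an expansion by `deg M` of some `U`, and `U ⇒ T` under the
-- same prefix types the abstraction.
... | U , p = U , subst (DegU _) (sym (Tm-deg t)) d'
            , (d' , Has-mono M (λ {v} _ → ≔-⊑ σ (x , _) (⊑-≈ p) v) m)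
            , Each-ēs⁻ [] (deg M) (Has-≈⇐ N p n)
  where d' = DegU-≈⇐ p d
Has-▷β (▷-appˡ r) (a , b) g (U , d , p , q) = U , d , Has-▷β r a g p , q
Has-▷β (▷-appʳ r) (a , b) g (U , d , p , q) =
  U , subst (DegU _) (deg-▷β r) d , p , Each-map (Has-▷β r b g) U q
Has-▷β {T = U ⇒ T} (▷-lam r) (_ , a) g (d , p) = d , Has-▷β r a (≔-graded g d) p

-- Gradedness is carried forward along the reduction and typing backward, so that the source of each
-- step is known to be graded.
Has-▷β* : ∀ {M N σ L T} → M ▷β* N → Graded M → GradedCtx σ → Has N σ L T → Has M σ L T
Has-▷β* (▷*-α p)       a g h = Has-=α (=α-sym p) h
Has-▷β* (▷*-step r s)  a g h = Has-▷β r a g (Has-▷β* s (Graded-▷β r a) g h)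
Has-▷β* (▷*-αstep p s) a g h = Has-=α (=α-sym p) (Has-▷β* s (Graded-=α p a) g h)

-- Environments

dom⁺ : ∀ {v U Γ} → (v , U) ∈ Γ → v ∈ dom Γ
dom⁺ = ∈-map⁺ proj₁

dom⁻ : ∀ {v} Γ → v ∈ dom Γ → ∃[ U ] (v , U) ∈ Γ
dom⁻ Γ v∈ with ∈-map⁻ proj₁ {xs = Γ} v∈
... | (_ , U) , p , refl = U , p

lookupE-just : ∀ Γ {v U} → lookupE Γ v ≡ just U → (v , U) ∈ Γ
lookupE-just ((w , W) ∷ Γ) {v} e with v ≟ᵥ w
lookupE-just ((w , W) ∷ Γ) refl | yes refl = here refl
lookupE-just ((w , W) ∷ Γ) e    | no _     = there (lookupE-just Γ e)

lookupE-nothing : ∀ Γ {v} → lookupE Γ v ≡ nothing → v ∉ dom Γ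
lookupE-nothing ((w , W) ∷ Γ) {v} e v∈ with v ≟ᵥ w
lookupE-nothing ((w , W) ∷ Γ) e (here p)   | no v≢w = v≢w p
lookupE-nothing ((w , W) ∷ Γ) e (there v∈) | no _   = lookupE-nothing Γ e v∈

-- Weaker than distinct keys: a declaration may be listed twice, since `≐` compares lists as sets.
Functional : Env → Set
Functional Γ = ∀ {v U V} → (v , U) ∈ Γ → (v , V) ∈ Γ → U ≡ V

data Meet (Γ₁ Γ₂ : Env) (v : Var) : TyU → Set where
  both  : ∀ {U V} → (v , U) ∈ Γ₁ → (v , V) ∈ Γ₂ → Meet Γ₁ Γ₂ v (U ⊓ V)
  left  : ∀ {U} → (v , U) ∈ Γ₁ → v ∉ dom Γ₂ → Meet Γ₁ Γ₂ v U
  right : ∀ {U} → (v , U) ∈ Γ₂ → v ∉ dom Γ₁ → Meet Γ₁ Γ₂ v U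

∈-⊓ᴱ⁻ : ∀ Γ₁ Γ₂ {v W} → (v , W) ∈ (Γ₁ ⊓ᴱ Γ₂) → Meet Γ₁ Γ₂ v W
∈-⊓ᴱ⁻ Γ₁ Γ₂ d∈ with ∈-++⁻ (map _ Γ₁) d∈
... | inj₂ p with ∈-filter⁻ (λ d → ¬? (proj₁ d ∈? dom Γ₁)) {xs = Γ₂} p
...   | q , v∉ = right q v∉
∈-⊓ᴱ⁻ Γ₁ Γ₂ d∈ | inj₁ p with ∈-map⁻ _ {xs = Γ₁} p
... | (w , U) , q , e with lookupE Γ₂ w in eq
∈-⊓ᴱ⁻ Γ₁ Γ₂ d∈ | inj₁ p | (w , U) , q , refl | just V  = both q (lookupE-just Γ₂ eq)
∈-⊓ᴱ⁻ Γ₁ Γ₂ d∈ | inj₁ p | (w , U) , q , refl | nothing = left q (lookupE-nothing Γ₂ eq)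

-- The function mapped in `_⊓ᴱ_` is local to that definition; the equation, proved by `refl`, lets
-- unification supply it.
∈-map-++ : ∀ {A : Set} {f : A → A} {xs ys zs x} → zs ≡ map f xs ++ ys → x ∈ xs → f x ∈ zs
∈-map-++ {f = f} refl x∈ = ∈-++⁺ˡ (∈-map⁺ f x∈)

dom-⊓ᴱˡ : ∀ Γ₁ Γ₂ {v} → v ∈ dom Γ₁ → v ∈ dom (Γ₁ ⊓ᴱ Γ₂)
dom-⊓ᴱˡ Γ₁ Γ₂ {v} v∈ with dom⁻ Γ₁ v∈
... | U , p with lookupE Γ₂ v | ∈-map-++ {zs = Γ₁ ⊓ᴱ Γ₂} refl p
...   | just _  | q = dom⁺ q
...   | nothing | q = dom⁺ q

dom-⊓ᴱʳ : ∀ Γ₁ Γ₂ {v} → v ∈ dom Γ₂ → v ∈ dom (Γ₁ ⊓ᴱ Γ₂)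
dom-⊓ᴱʳ Γ₁ Γ₂ {v} v∈ with v ∈? dom Γ₁ | dom⁻ Γ₂ v∈
... | yes p | _     = dom-⊓ᴱˡ Γ₁ Γ₂ p
... | no v∉ | U , q = dom⁺ (∈-++⁺ʳ (map _ Γ₁) (∈-filter⁺ (λ d → ¬? (proj₁ d ∈? dom Γ₁)) q v∉))

dom-⊓ᴱ⁻ : ∀ Γ₁ Γ₂ {v} → v ∈ dom (Γ₁ ⊓ᴱ Γ₂) → v ∈ dom Γ₁ ⊎ v ∈ dom Γ₂
dom-⊓ᴱ⁻ Γ₁ Γ₂ v∈ with dom⁻ (Γ₁ ⊓ᴱ Γ₂) v∈
... | _ , p with ∈-⊓ᴱ⁻ Γ₁ Γ₂ p
...   | both q _  = inj₁ (dom⁺ q)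
...   | left q _  = inj₁ (dom⁺ q)
...   | right q _ = inj₂ (dom⁺ q)

⊓ᴱ-functional : ∀ Γ₁ Γ₂ → Functional Γ₁ → Functional Γ₂ → Functional (Γ₁ ⊓ᴱ Γ₂)
⊓ᴱ-functional Γ₁ Γ₂ f₁ f₂ p q with ∈-⊓ᴱ⁻ Γ₁ Γ₂ p | ∈-⊓ᴱ⁻ Γ₁ Γ₂ q
... | both a b   | both c d   = cong₂ _⊓_ (f₁ a c) (f₂ b d)
... | both a b   | left c ∉₂  = ⊥-elim (∉₂ (dom⁺ b))
... | both a b   | right d ∉₁ = ⊥-elim (∉₁ (dom⁺ a))
... | left a ∉₂  | both c d   = ⊥-elim (∉₂ (dom⁺ d))
... | left a ∉₂  | left c _   = f₁ a c
... | left a ∉₂  | right d ∉₁ = ⊥-elim (∉₁ (dom⁺ a))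
... | right b ∉₁ | both c d   = ⊥-elim (∉₁ (dom⁺ c))
... | right b ∉₁ | left c ∉₂  = ⊥-elim (∉₂ (dom⁺ b))
... | right b ∉₁ | right d _  = f₂ b d

⊑ᴱ-dom⇒ : ∀ {Γ Δ v} → Γ ⊑ᴱ Δ → v ∈ dom Γ → v ∈ dom Δ
⊑ᴱ-dom⇒ {Γ} (⊑ᴱ-refl p) v∈ = dom⁺ (proj₁ (p _) (proj₂ (dom⁻ Γ v∈)))
⊑ᴱ-dom⇒ (⊑ᴱ-trans p q)  v∈ = ⊑ᴱ-dom⇒ q (⊑ᴱ-dom⇒ p v∈)
⊑ᴱ-dom⇒ (⊑ᴱ-ext _ _)    v∈ = v∈

⊑ᴱ-dom⇐ : ∀ {Γ Δ v} → Γ ⊑ᴱ Δ → v ∈ dom Δ → v ∈ dom Γ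
⊑ᴱ-dom⇐ {Δ = Δ} (⊑ᴱ-refl p) v∈ = dom⁺ (proj₂ (p _) (proj₂ (dom⁻ Δ v∈)))
⊑ᴱ-dom⇐ (⊑ᴱ-trans p q)      v∈ = ⊑ᴱ-dom⇐ p (⊑ᴱ-dom⇐ q v∈)
⊑ᴱ-dom⇐ (⊑ᴱ-ext _ _)        v∈ = v∈

⊑ᴱ-functional : ∀ {Γ Δ} → Γ ⊑ᴱ Δ → Functional Δ → Functional Γ
⊑ᴱ-functional (⊑ᴱ-refl p)    f a b = f (proj₁ (p _) a) (proj₁ (p _) b)
⊑ᴱ-functional (⊑ᴱ-trans p q) f = ⊑ᴱ-functional p (⊑ᴱ-functional q f)
⊑ᴱ-functional (⊑ᴱ-ext y∉ _)  f (here refl) (here refl) = refl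
⊑ᴱ-functional (⊑ᴱ-ext y∉ _)  f (here refl) (there b)   = ⊥-elim (y∉ (dom⁺ b))
⊑ᴱ-functional (⊑ᴱ-ext y∉ _)  f (there a)   (here refl) = ⊥-elim (y∉ (dom⁺ a))
⊑ᴱ-functional (⊑ᴱ-ext y∉ _)  f (there a)   (there b)   = f (there a) (there b)

GradedEnv : Env → Set
GradedEnv Γ = ∀ {v U} → (v , U) ∈ Γ → DegU U (proj₂ v)

⊑ᴱ-graded : ∀ {Γ Δ} → Γ ⊑ᴱ Δ → GradedEnv Δ → GradedEnv Γ
⊑ᴱ-graded (⊑ᴱ-refl p)    g a           = g (proj₁ (p _) a)
⊑ᴱ-graded (⊑ᴱ-trans p q) g a           = ⊑ᴱ-graded p (⊑ᴱ-graded q g) a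
⊑ᴱ-graded (⊑ᴱ-ext _ s)   g (here refl) = DegU-⊑⇐ s (g (here refl))
⊑ᴱ-graded (⊑ᴱ-ext _ _)   g (there a)   = g (there a)

_≼_ : Ctx → Env → Set
σ ≼ Γ = ∀ {v U} → (v , U) ∈ Γ → σ v ⊑ U

≼-⊑ᴱ : ∀ {σ Γ Δ} → Γ ⊑ᴱ Δ → σ ≼ Γ → σ ≼ Δ
≼-⊑ᴱ (⊑ᴱ-refl p)    h a           = h (proj₂ (p _) a)
≼-⊑ᴱ (⊑ᴱ-trans p q) h a           = ≼-⊑ᴱ q (≼-⊑ᴱ p h) a
≼-⊑ᴱ (⊑ᴱ-ext _ s)   h (here refl) = ⊑-trans (h (here refl)) s
≼-⊑ᴱ (⊑ᴱ-ext _ _)   h (there a)   = h (there a)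

≼-⊓ᴱ⁺ : ∀ {σ} Γ₁ Γ₂ → σ ≼ Γ₁ → σ ≼ Γ₂ → σ ≼ (Γ₁ ⊓ᴱ Γ₂)
≼-⊓ᴱ⁺ Γ₁ Γ₂ h k a with ∈-⊓ᴱ⁻ Γ₁ Γ₂ a
... | both p q  = ⊑-glb (h p) (k q)
... | left p _  = h p
... | right q _ = k q

-- A type in the meet is below the one it came from, so a single `σ` serves both sides of an
-- application. Functionality identifies the declaration found in the meet with the given one.
≼-⊓ᴱˡ : ∀ {σ} Γ₁ Γ₂ → Functional Γ₁ → GradedEnv Γ₁ → GradedEnv Γ₂ → σ ≼ (Γ₁ ⊓ᴱ Γ₂) → σ ≼ Γ₁
≼-⊓ᴱˡ Γ₁ Γ₂ f g₁ g₂ h a with dom⁻ (Γ₁ ⊓ᴱ Γ₂) (dom-⊓ᴱˡ Γ₁ Γ₂ (dom⁺ a))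
... | _ , p with h p | ∈-⊓ᴱ⁻ Γ₁ Γ₂ p
...   | s | both b c  = ⊑-trans s (⊑-trans (⊑-⊓ᵉ (g₁ b) (g₂ c)) (⊑-reflexive (f b a)))
...   | s | left b _  = ⊑-trans s (⊑-reflexive (f b a))
...   | s | right _ ∉ = ⊥-elim (∉ (dom⁺ a))

≼-⊓ᴱʳ : ∀ {σ} Γ₁ Γ₂ → Functional Γ₂ → GradedEnv Γ₁ → GradedEnv Γ₂ → σ ≼ (Γ₁ ⊓ᴱ Γ₂) → σ ≼ Γ₂
≼-⊓ᴱʳ Γ₁ Γ₂ f g₁ g₂ h a with dom⁻ (Γ₁ ⊓ᴱ Γ₂) (dom-⊓ᴱʳ Γ₁ Γ₂ (dom⁺ a))
... | _ , p with h p | ∈-⊓ᴱ⁻ Γ₁ Γ₂ p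
...   | s | both b c  = ⊑-trans s (⊑-trans (⊑-⊓ʳ (g₁ b) (g₂ c)) (⊑-reflexive (f c a)))
...   | s | left _ ∉  = ⊥-elim (∉ (dom⁺ a))
...   | s | right c _ = ⊑-trans s (⊑-reflexive (f c a))

∈-ēᴱ⁻ : ∀ {j w W} Γ → (w , W) ∈ ēᴱ j Γ →
        Σ Var λ v → Σ TyU λ U → w ≡ liftᵥ j v × W ≡ ē j U × (v , U) ∈ Γ
∈-ēᴱ⁻ Γ a with ∈-map⁻ _ {xs = Γ} a
... | (v , U) , b , refl = v , U , refl , refl , b

∈-ēᴱ⁺ : ∀ {j v U Γ} → (v , U) ∈ Γ → (liftᵥ j v , ē j U) ∈ ēᴱ j Γ
∈-ēᴱ⁺ = ∈-map⁺ _

-- Restriction of a context to a finite set of variables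

decl : Ctx → List Var → Env
decl σ = map (λ v → v , σ v)

∈-decl⁺ : ∀ {σ v vs} → v ∈ vs → (v , σ v) ∈ decl σ vs
∈-decl⁺ = ∈-map⁺ _

∈-decl⁻ : ∀ {σ v U} vs → (v , U) ∈ decl σ vs → v ∈ vs × U ≡ σ v
∈-decl⁻ vs a with ∈-map⁻ _ {xs = vs} a
... | _ , v∈ , refl = v∈ , refl

decl-functional : ∀ {σ} vs → Functional (decl σ vs)
decl-functional vs a b = trans (proj₂ (∈-decl⁻ vs a)) (sym (proj₂ (∈-decl⁻ vs b)))

≐-sym : ∀ {Γ Δ} → Γ ≐ Δ → Δ ≐ Γ
≐-sym p d = proj₂ (p d) , proj₁ (p d)

≐-middle : ∀ {d} Γ Δ → (d ∷ Γ ++ Δ) ≐ (Γ ++ d ∷ Δ)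
≐-middle {d} Γ Δ e = to , from
  where
  to : e ∈ d ∷ Γ ++ Δ → e ∈ Γ ++ d ∷ Δ
  to (here refl) = ∈-++⁺ʳ Γ (here refl)
  to (there p) with ∈-++⁻ Γ p
  ... | inj₁ q = ∈-++⁺ˡ q
  ... | inj₂ q = ∈-++⁺ʳ Γ (there q)

  from : e ∈ Γ ++ d ∷ Δ → e ∈ d ∷ Γ ++ Δ
  from p with ∈-++⁻ Γ p
  ... | inj₁ q         = there (∈-++⁺ˡ q)
  ... | inj₂ (here q)  = here q
  ... | inj₂ (there q) = there (∈-++⁺ʳ Γ q)

-- ⊑ᴱ-ext changes only the head of the list, so the declarations are rotated through it.
decl-⊑ : ∀ {σ τ vs} Δ → Unique vs → (∀ {v} → v ∈ vs → v ∉ dom Δ) →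
         (∀ {v} → v ∈ vs → σ v ⊑ τ v) → (decl σ vs ++ Δ) ⊑ᴱ (decl τ vs ++ Δ)
decl-⊑ Δ [] fresh h = ⊑ᴱ-refl (λ _ → (λ p → p) , (λ p → p))
decl-⊑ {σ} {τ} {v ∷ vs} Δ (v∉ ∷ u) fresh h =
  ⊑ᴱ-trans (⊑ᴱ-ext v-new (h (here refl)))
    (⊑ᴱ-trans (⊑ᴱ-refl (≐-middle (decl σ vs) Δ))
      (⊑ᴱ-trans (decl-⊑ ((v , τ v) ∷ Δ) u fresh' (λ p → h (there p)))
        (⊑ᴱ-refl (≐-sym (≐-middle (decl τ vs) Δ)))))
  where
  v-new : v ∉ dom (decl σ vs ++ Δ)
  v-new p with dom⁻ (decl σ vs ++ Δ) p
  ... | _ , q with ∈-++⁻ (decl σ vs) q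
  ...   | inj₁ r = All¬⇒¬Any v∉ (proj₁ (∈-decl⁻ vs r))
  ...   | inj₂ r = fresh (here refl) (dom⁺ r)

  fresh' : ∀ {w} → w ∈ vs → w ∉ dom ((v , τ v) ∷ Δ)
  fresh' w∈ (here refl) = All¬⇒¬Any v∉ w∈
  fresh' w∈ (there p)   = fresh (there w∈) p

total : Env → Ctx
total Γ v = fromMaybe (ω (proj₂ v)) (lookupE Γ v)

∈-total : ∀ Γ {v} → v ∈ dom Γ → (v , total Γ v) ∈ Γ
∈-total Γ {v} v∈ with lookupE Γ v in eq
... | just U  = lookupE-just Γ eq
... | nothing = ⊥-elim (lookupE-nothing Γ eq v∈)

total-∉ : ∀ Γ {v} → v ∉ dom Γ → total Γ v ≡ ω (proj₂ v)
total-∉ Γ {v} v∉ with lookupE Γ v in eq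
... | just U  = ⊥-elim (v∉ (dom⁺ (lookupE-just Γ eq)))
... | nothing = refl

total-graded : ∀ Γ → GradedEnv Γ → GradedCtx (total Γ)
total-graded Γ g v with v ∈? dom Γ
... | yes v∈ = g (∈-total Γ v∈)
... | no v∉ rewrite total-∉ Γ v∉ = d-ω _

≐-decl-total : ∀ Γ vs → Functional Γ → (∀ {v} → v ∈ vs → v ∈ dom Γ) →
               (∀ {v} → v ∈ dom Γ → v ∈ vs) → Γ ≐ decl (total Γ) vs
≐-decl-total Γ vs f to from (v , U) =
  (λ a → subst (λ W → (v , W) ∈ decl (total Γ) vs) (f (∈-total Γ (dom⁺ a)) a) (∈-decl⁺ (from (dom⁺ a)))) ,
  (λ a → subst (λ W → (v , W) ∈ Γ) (sym (proj₂ (∈-decl⁻ vs a))) (∈-total Γ (to (proj₁ (∈-decl⁻ vs a)))))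

-- `⊑ᴱ` changes one declaration at a time, so both environments are first rewritten, as sets, over
-- one duplicate-free list of variables.
⊑ᴱ-pointwise : ∀ {Γ Δ} → Functional Γ → Functional Δ →
               (∀ {v} → v ∈ dom Γ → v ∈ dom Δ) → (∀ {v} → v ∈ dom Δ → v ∈ dom Γ) →
               (∀ {v U V} → (v , U) ∈ Γ → (v , V) ∈ Δ → U ⊑ V) → Γ ⊑ᴱ Δ
⊑ᴱ-pointwise {Γ} {Δ} f g to from h =
  ⊑ᴱ-trans (⊑ᴱ-refl (≐-decl-total Γ vs f vs⊆ ⊆vs))
    (⊑ᴱ-trans (subst₂ _⊑ᴱ_ (++-identityʳ _) (++-identityʳ _) middle)
      (⊑ᴱ-refl (≐-sym (≐-decl-total Δ vs g (λ p → to (vs⊆ p)) (λ p → ⊆vs (from p))))))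
  where
  vs : List Var
  vs = deduplicate _≟ᵥ_ (dom Γ)

  vs⊆ : ∀ {v} → v ∈ vs → v ∈ dom Γ
  vs⊆ = ∈-deduplicate⁻ _≟ᵥ_ (dom Γ)

  ⊆vs : ∀ {v} → v ∈ dom Γ → v ∈ vs
  ⊆vs = ∈-deduplicate⁺ _≟ᵥ_

  middle : (decl (total Γ) vs ++ []) ⊑ᴱ (decl (total Δ) vs ++ [])
  middle = decl-⊑ [] (deduplicate-! _≟ᵥ_ (dom Γ)) (λ _ ())
             (λ v∈ → h (∈-total Γ (vs⊆ v∈)) (∈-total Δ (to (vs⊆ v∈))))

-- The typing rules against Has

-- Invariants of derivable typings. That the domain is exactly `fv M` lets an environment be rebuilt
-- from a total context and the subject.
record Regular (M : Λ) (Γ : Env) (U : TyU) : Set where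
  field
    functional : Functional Γ
    graded     : GradedEnv Γ
    dom⊆fv     : ∀ {v} → v ∈ dom Γ → v ∈ fv M
    fv⊆dom     : ∀ {v} → v ∈ fv M → v ∈ dom Γ
    degree     : DegU U (deg M)

open Regular

dom-envω⁻ : ∀ M {v} → v ∈ dom (envω M) → v ∈ fv M
dom-envω⁻ M v∈ =
  ∈-deduplicate⁻ _≟ᵥ_ (fv M) (proj₁ (∈-decl⁻ {λ v → ω (proj₂ v)} _ (proj₂ (dom⁻ (envω M) v∈))))

regular : ∀ {M Γ U} → M ∶ ⟨ Γ ⊢ U ⟩ → Regular M Γ U
regular (ax w) = record
  { functional = λ { (here refl) (here refl) → refl }
  ; graded     = λ { (here refl) → d-T w }
  ; dom⊆fv     = λ { (here refl) → here refl }
  ; fv⊆dom     = λ { (here refl) → here refl }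
  ; degree     = d-T w
  }
regular (ω-r {M} t) = record
  { functional = decl-functional _
  ; graded     = λ a → subst (λ W → DegU W _) (sym (proj₂ (∈-decl⁻ {λ v → ω (proj₂ v)} _ a))) (d-ω _)
  ; dom⊆fv     = dom-envω⁻ M
  ; fv⊆dom     = λ v∈ → dom⁺ (∈-decl⁺ {λ v → ω (proj₂ v)} (∈-deduplicate⁺ _≟ᵥ_ v∈))
  ; degree     = subst (DegU _) (sym (Tm-deg t)) (d-ω _)
  }
regular (→I {x} {L} {M} {Γ = Γ} {U} {T} _ x∉ d) = record
  { functional = λ a b → functional r (there a) (there b)
  ; graded     = λ a → graded r (there a)
  ; dom⊆fv     = λ v∈ → fv-lam⁺ M (dom⊆fv r (there v∈)) λ { refl → x∉ v∈ }
  ; fv⊆dom     = λ v∈ → from-body (fv-lam⁻ M v∈)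
  ; degree     = arrow (degree r)
  }
  where
  r : Regular M (((x , L) , U) ∷ Γ) ⌜ T ⌝
  r = regular d

  from-body : ∀ {v} → v ∈ fv M × v ≢ (x , L) → v ∈ dom Γ
  from-body (v∈ , v≢x) with fv⊆dom r v∈
  ... | here refl = ⊥-elim (v≢x refl)
  ... | there p   = p

  arrow : ∀ {K} → DegU ⌜ T ⌝ K → DegU ⌜ U ⇒ T ⌝ K
  arrow (d-T w) = d-T (wf-⇒ (graded r (here refl)) w)
regular (→'I {x} {L} {M} {Γ = Γ} {T} _ x∉ d) = record
  { functional = functional r
  ; graded     = graded r
  ; dom⊆fv     = λ v∈ → fv-lam⁺ M (dom⊆fv r v∈) λ { refl → x∉ v∈ }
  ; fv⊆dom     = λ v∈ → fv⊆dom r (proj₁ (fv-lam⁻ M v∈))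
  ; degree     = arrow (degree r)
  }
  where
  r : Regular M Γ ⌜ T ⌝
  r = regular d

  arrow : ∀ {K} → DegU ⌜ T ⌝ K → DegU ⌜ ω L ⇒ T ⌝ K
  arrow (d-T w) = d-T (wf-⇒ (d-ω L) w)
regular (→E {M₁} {M₂} {_} {Γ₁} {Γ₂} {U} {T} _ d₁ d₂ _) = record
  { functional = ⊓ᴱ-functional Γ₁ Γ₂ (functional r₁) (functional r₂)
  ; graded     = λ a → meet (∈-⊓ᴱ⁻ Γ₁ Γ₂ a)
  ; dom⊆fv     = λ v∈ → [ (λ p → ∈-++⁺ˡ (dom⊆fv r₁ p)) , (λ p → ∈-++⁺ʳ (fv M₁) (dom⊆fv r₂ p)) ]
                          (dom-⊓ᴱ⁻ Γ₁ Γ₂ v∈)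
  ; fv⊆dom     = λ v∈ → [ (λ p → dom-⊓ᴱˡ Γ₁ Γ₂ (fv⊆dom r₁ p)) , (λ p → dom-⊓ᴱʳ Γ₁ Γ₂ (fv⊆dom r₂ p)) ]
                          (∈-++⁻ (fv M₁) v∈)
  ; degree     = target (degree r₁)
  }
  where
  r₁ : Regular M₁ Γ₁ ⌜ U ⇒ T ⌝
  r₁ = regular d₁

  r₂ : Regular M₂ Γ₂ U
  r₂ = regular d₂

  meet : ∀ {v W} → Meet Γ₁ Γ₂ v W → DegU W (proj₂ v)
  meet (both p q)  = d-⊓ (graded r₁ p) (graded r₂ q)
  meet (left p _)  = graded r₁ p
  meet (right q _) = graded r₂ q

  target : ∀ {K} → DegU ⌜ U ⇒ T ⌝ K → DegU ⌜ T ⌝ K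
  target (d-T (wf-⇒ _ w)) = d-T w
regular (⊓I d₁ d₂) = record
  { functional = functional r
  ; graded     = graded r
  ; dom⊆fv     = dom⊆fv r
  ; fv⊆dom     = fv⊆dom r
  ; degree     = d-⊓ (degree r) (degree (regular d₂))
  }
  where r = regular d₁
regular (e-r {M} {Γ} {U} j d) = record
  { functional = unique
  ; graded     = grade
  ; dom⊆fv     = into
  ; fv⊆dom     = onto
  ; degree     = subst (DegU _) (sym (deg-lift j M)) (d-e (degree r))
  }
  where
  r : Regular M Γ U
  r = regular d

  unique : Functional (ēᴱ j Γ)
  unique a b with ∈-ēᴱ⁻ Γ a | ∈-ēᴱ⁻ Γ b
  ... | _ , _ , refl , refl , p | _ , _ , refl , refl , q = cong (ē j) (functional r p q)

  grade : GradedEnv (ēᴱ j Γ)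
  grade a with ∈-ēᴱ⁻ Γ a
  ... | _ , _ , refl , refl , p = d-e (graded r p)

  into : ∀ {v} → v ∈ dom (ēᴱ j Γ) → v ∈ fv (lift j M)
  into v∈ with dom⁻ (ēᴱ j Γ) v∈
  ... | _ , a with ∈-ēᴱ⁻ Γ a
  ...   | _ , _ , refl , refl , p = fv-lift⁺ j M (dom⊆fv r (dom⁺ p))

  onto : ∀ {v} → v ∈ fv (lift j M) → v ∈ dom (ēᴱ j Γ)
  onto v∈ with fv-lift⁻ j M v∈
  ... | _ , refl , p = dom⁺ (∈-ēᴱ⁺ (proj₂ (dom⁻ Γ (fv⊆dom r p))))
regular (⊑-r d (⊑ᵀ-intro s e)) = record
  { functional = ⊑ᴱ-functional e (functional r)
  ; graded     = ⊑ᴱ-graded e (graded r)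
  ; dom⊆fv     = λ v∈ → dom⊆fv r (⊑ᴱ-dom⇒ e v∈)
  ; fv⊆dom     = λ v∈ → ⊑ᴱ-dom⇐ e (fv⊆dom r v∈)
  ; degree     = DegU-⊑⇒ s (degree r)
  }
  where r = regular d
regular (α-r p d) = record
  { functional = functional r
  ; graded     = graded r
  ; dom⊆fv     = λ v∈ → =α-fv p (dom⊆fv r v∈)
  ; fv⊆dom     = λ v∈ → fv⊆dom r (=α-fv (=α-sym p) v∈)
  ; degree     = subst (DegU _) (deg-=α p) (degree r)
  }
  where r = regular d

≼-≔ : ∀ {σ v U Γ} → v ∉ dom Γ → σ ≼ Γ → (σ [ v ≔ U ]) ≼ Γ
≼-≔ {σ} v∉ h a = ⊑-trans (⊑-reflexive (≔-miss σ λ { refl → v∉ (dom⁺ a) })) (h a)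

-- The induction runs over all graded `σ` below `Γ`: both sides of an application keep the same `σ`,
-- binders update it, and lifting replaces it by `unᶜ j σ`.
sound : ∀ {M Γ U σ} → M ∶ ⟨ Γ ⊢ U ⟩ → GradedCtx σ → σ ≼ Γ → Each (Has M σ) [] U
sound (ax w) g h = h (here refl)
sound (ω-r t) g h = tt
sound {σ = σ} (→I {x} {L} _ x∉ d) g h = c , sound d (≔-graded g c) below
  where
  c = graded (regular d) (here refl)

  below : (σ [ x , L ≔ _ ]) ≼ _
  below (here refl) = ⊑-reflexive (≔-hit σ (x , L))
  below (there a)   = ≼-≔ x∉ h a
sound (→'I _ x∉ d) g h = d-ω _ , sound d (≔-graded g (d-ω _)) (≼-≔ x∉ h)
sound (→E {Γ₁ = Γ₁} {Γ₂} {U} _ d₁ d₂ _) g h =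
  U , degree r₂
    , sound d₁ g (≼-⊓ᴱˡ Γ₁ Γ₂ (functional r₁) (graded r₁) (graded r₂) h)
    , sound d₂ g (≼-⊓ᴱʳ Γ₁ Γ₂ (functional r₂) (graded r₁) (graded r₂) h)
  where
  r₁ = regular d₁
  r₂ = regular d₂
sound (⊓I d₁ d₂) g h = sound d₁ g h , sound d₂ g h
sound (e-r {M} {U = U} j d) g h =
  Each-shift (Has-lift⁺ j M g) U (sound d (unᶜ-graded g) (λ a → un-⊑ (h (∈-ēᴱ⁺ a))))
sound {M} (⊑-r d (⊑ᵀ-intro s e)) g h = Has-⊑ M s (sound d g (≼-⊑ᴱ e h))
sound {U = U} (α-r p d) g h = Each-map (Has-=α p) U (sound d g h)

-- Completeness: typing derivations from `Has`

_↾_ : Ctx → Λ → Env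
σ ↾ M = decl σ (deduplicate _≟ᵥ_ (fv M))

∈-↾⁺ : ∀ {v U} σ M → v ∈ fv M → σ v ≡ U → (v , U) ∈ (σ ↾ M)
∈-↾⁺ σ M v∈ refl = ∈-decl⁺ (∈-deduplicate⁺ _≟ᵥ_ v∈)

∈-↾⁻ : ∀ {σ v U} M → (v , U) ∈ (σ ↾ M) → v ∈ fv M × U ≡ σ v
∈-↾⁻ M a with ∈-decl⁻ (deduplicate _≟ᵥ_ (fv M)) a
... | v∈ , e = ∈-deduplicate⁻ _≟ᵥ_ (fv M) v∈ , e

dom-↾⁻ : ∀ {σ v} M → v ∈ dom (σ ↾ M) → v ∈ fv M
dom-↾⁻ {σ} M v∈ = proj₁ (∈-↾⁻ M (proj₂ (dom⁻ (σ ↾ M) v∈)))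

-- By `regular` the domain of `Γ` is already `fv M`, so only types differ and `⊑-r` closes the gap.
-- Completeness may thus use whatever environment a rule yields.
restrict : ∀ {M Γ U σ} → σ ≼ Γ → M ∶ ⟨ Γ ⊢ U ⟩ → M ∶ ⟨ σ ↾ M ⊢ U ⟩
restrict {M} {Γ} {σ = σ} h d = ⊑-r d (⊑ᵀ-intro ⊑-refl
  (⊑ᴱ-pointwise (decl-functional _) (functional r)
    (λ v∈ → fv⊆dom r (dom-↾⁻ M v∈)) (λ v∈ → dom⁺ (∈-↾⁺ σ M (dom⊆fv r v∈) refl))
    (λ a b → ⊑-trans (⊑-reflexive (proj₂ (∈-↾⁻ M a))) (h b))))
  where r = regular d

↾-≼ : ∀ {σ} M → σ ≼ (σ ↾ M)
↾-≼ M a = ⊑-reflexive (sym (proj₂ (∈-↾⁻ M a)))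

abstraction : ∀ {x K M L σ U T} → Tm (lam x K M) L → DegU U K →
              M ∶ ⟨ (σ [ x , K ≔ U ]) ↾ M ⊢ ⌜ T ⌝ ⟩ → lam x K M ∶ ⟨ σ ↾ lam x K M ⊢ ⌜ U ⇒ T ⌝ ⟩
abstraction {x} {K} {M} {σ = σ} {U} t u d with (x , K) ∈? fv M
... | yes x∈ = →I t x∉ (⊑-r d (⊑ᵀ-intro ⊑-refl (⊑ᴱ-refl λ e → to , from)))
  where
  Γ = σ ↾ lam x K M

  x∉ : (x , K) ∉ dom Γ
  x∉ p = proj₂ (fv-lam⁻ M (dom-↾⁻ (lam x K M) p)) refl

  to : ∀ {e} → e ∈ ((x , K) , U) ∷ Γ → e ∈ ((σ [ x , K ≔ U ]) ↾ M)
  to (here refl) = ∈-↾⁺ (σ [ x , K ≔ U ]) M x∈ (≔-hit σ (x , K))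
  to (there a) with ∈-↾⁻ (lam x K M) a
  ... | v∈ , refl with fv-lam⁻ M v∈
  ...   | v∈M , v≢x = ∈-↾⁺ (σ [ x , K ≔ U ]) M v∈M (≔-miss σ v≢x)

  from : ∀ {e} → e ∈ ((σ [ x , K ≔ U ]) ↾ M) → e ∈ ((x , K) , U) ∷ Γ
  from {v , W} a with ∈-↾⁻ M a
  ... | v∈ , refl with toSum (v ≟ᵥ (x , K))
  ...   | inj₁ refl = here (cong (v ,_) (≔-hit σ v))
  ...   | inj₂ v≢x  = there (∈-↾⁺ σ (lam x K M) (fv-lam⁺ M v∈ v≢x) (sym (≔-miss σ v≢x)))
-- A bound variable that does not occur is first given `ω K`; contravariance then replaces it by the
-- smaller type `U`.
... | no x∉ = restrict below
    (⊑-r (→'I t (λ p → x∉ (dom-↾⁻ M p)) d)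
         (⊑ᵀ-intro (⊑-⇒ (⊑-ω u) ⊑-refl) (⊑ᴱ-refl λ _ → (λ p → p) , (λ p → p))))
  where
  below : σ ≼ ((σ [ x , K ≔ U ]) ↾ M)
  below a with ∈-↾⁻ M a
  ... | v∈ , refl = ⊑-reflexive (sym (≔-miss σ λ { refl → x∉ v∈ }))

size : Λ → ℕ
size (var x L)   = 1
size (app M N)   = suc (size M ℕ.+ size N)
size (lam x L M) = suc (size M)

size-lift : ∀ j M → size (lift j M) ≡ size M
size-lift j (var x L)   = refl
size-lift j (app M N)   = cong₂ (λ m n → suc (m ℕ.+ n)) (size-lift j M) (size-lift j N)
size-lift j (lam x L M) = cong suc (size-lift j M)

-- The case ē i U passes from M to the term it is the lifting of, which is not a subterm of M but has
-- the same size.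
complete : ∀ n M {K σ} U → size M ≤ n → Tm M K → GradedCtx σ → DegU U K →
           Each (Has M σ) [] U → M ∶ ⟨ σ ↾ M ⊢ U ⟩
complete n M (ω K) s t g (d-ω _) h = restrict below (ω-r t)
  where
  below : _ ≼ envω M
  below {v} a with ∈-decl⁻ {λ v → ω (proj₂ v)} _ a
  ... | _ , refl = ⊑-ω (g v)
complete n M (U ⊓ V) s t g (d-⊓ d e) (h , k) = ⊓I (complete n M U s t g d h) (complete n M V s t g e k)
complete n M {σ = σ} (ē i U) s t g (d-e d) h with Tm-lift⁻ t
... | M₀ , refl , t₀ = restrict below (e-r i
        (complete n M₀ U (subst (_≤ n) (size-lift i M₀) s) t₀ (unᶜ-graded g) d
          (Each-unshift (Has-lift⁻ i M₀) U h)))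
  where
  below : σ ≼ ēᴱ i (unᶜ i σ ↾ M₀)
  below a with ∈-ēᴱ⁻ (unᶜ i σ ↾ M₀) a
  ... | v , _ , refl , refl , b with ∈-↾⁻ M₀ b
  ...   | _ , refl = ⊑-≈ (≈-sym (ē-un (g (liftᵥ i v))))
-- A type of 𝕋 has degree ⊘, so the variable has the empty index and `ax` applies.
complete n (var x []) {σ = σ} ⌜ T ⌝ s (tvar x []) g (d-T w) h = restrict {σ = σ} (λ { (here refl) → h }) (ax w)
complete (suc n) (app M N) ⌜ T ⌝ (s≤s s) (tapp {K = K} t u p j) g (d-T w) (U , d , h , k) =
  restrict (≼-⊓ᴱ⁺ _ _ (↾-≼ M) (↾-≼ N))
    (→E (tapp t u p j)
      (complete n M ⌜ U ⇒ T ⌝ (≤-trans (m≤m+n _ _) s) t g (d-T (proj₂ (Has-graded M g h))) h)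
      (complete n N U (≤-trans (m≤n+m _ _) s) u g (subst (DegU _) (Tm-deg u) d) k)
      -- Joinability of `M` and `N` passes to the environments, whose domains consist of free
      -- variables.
      (λ x L K a b → j x L K (dom-↾⁻ M a) (dom-↾⁻ N b)))
complete (suc n) (lam x K M) ⌜ U ⇒ T ⌝ (s≤s s) (tlam t p) g (d-T (wf-⇒ _ w)) (d , h) =
  abstraction (tlam t p) d (complete n M ⌜ T ⌝ s t (≔-graded g d) (d-T w) h)

-- From total contexts back to `Γ ↑ M`

total-≼ : ∀ Γ → Functional Γ → total Γ ≼ Γ
total-≼ Γ f a = ⊑-reflexive (f (∈-total Γ (dom⁺ a)) a)

-- The default `ω` of `total` is what `_↑_` adds, so both sides list the values of `total Γ` on
-- `fv M`.
↑-≐-total : ∀ Γ M → Functional Γ → (∀ {v} → v ∈ dom Γ → v ∈ fv M) → (Γ ↑ M) ≐ (total Γ ↾ M)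
↑-≐-total Γ M f sub (v , U) = to , from
  where
  rest = filter (λ v → ¬? (v ∈? dom Γ)) (deduplicate _≟ᵥ_ (fv M))

  to : (v , U) ∈ (Γ ↑ M) → (v , U) ∈ (total Γ ↾ M)
  to a with ∈-++⁻ Γ a
  ... | inj₁ b = ∈-↾⁺ (total Γ) M (sub (dom⁺ b)) (f (∈-total Γ (dom⁺ b)) b)
  ... | inj₂ b with ∈-decl⁻ {λ v → ω (proj₂ v)} rest b
  ...   | v∈ , refl with ∈-filter⁻ (λ v → ¬? (v ∈? dom Γ)) {xs = deduplicate _≟ᵥ_ (fv M)} v∈
  ...     | p , v∉ = ∈-↾⁺ (total Γ) M (∈-deduplicate⁻ _≟ᵥ_ (fv M) p) (total-∉ Γ v∉)

  from : (v , U) ∈ (total Γ ↾ M) → (v , U) ∈ (Γ ↑ M)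
  from a with ∈-↾⁻ M a
  ... | v∈ , refl with toSum (v ∈? dom Γ)
  ...   | inj₁ p  = ∈-++⁺ˡ (∈-total Γ p)
  ...   | inj₂ v∉ = ∈-++⁺ʳ Γ (subst (λ W → (v , W) ∈ decl (λ w → ω (proj₂ w)) rest) (sym (total-∉ Γ v∉))
                      (∈-decl⁺ (∈-filter⁺ (λ v → ¬? (v ∈? dom Γ)) (∈-deduplicate⁺ _≟ᵥ_ v∈) v∉)))

theorem5 : ∀ {M N : Λ} {L : Index} {Γ : Env} {U : TyU} →
    Tm M L → M ▷β* N → N ∶ ⟨ Γ ⊢ U ⟩ → M ∶ ⟨ Γ ↑ M ⊢ U ⟩
theorem5 {M} {N} {L} {Γ} {U} t r d =
  -- The typing of `N` is read in `total Γ`, pulled back along the reduction, and turned into a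
  -- derivation for `M`.
  ⊑-r (complete (size M) M U ≤-refl t g u
         (Each-map (Has-▷β* r (Tm-Graded t) g) U (sound d g (total-≼ Γ (functional reg)))))
      (⊑ᵀ-intro ⊑-refl
        (⊑ᴱ-refl (↑-≐-total Γ M (functional reg) (λ v∈ → fv-▷β* r (dom⊆fv reg v∈)))))
  where
  reg : Regular N Γ U
  reg = regular d

  g : GradedCtx (total Γ)
  g = total-graded Γ (graded reg)

  u : DegU U L
  u = subst (DegU U) (trans (deg-▷β* r) (Tm-deg t)) (degree reg)
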